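{- For every positive integer $m$ there exist a finite alphabet $\Sigma$, two languages $K_m, L_m \subseteq \Sigma^\star$, and a sentence $\varphi_m \in \mathrm{FO}^2_m[<,\mathrm{suc}]$ such that $\varphi_m$ separates $K_m$ and $L_m$, but no $\psi \in \mathrm{FO}^2_{m-1}[<,\mathrm{suc}]$ separates $K_m$ and $L_m$.
   Context: Words $w=w_1\cdots w_{|w|}\in\Sigma^\star$ are structures with universe $\{1,\dots,|w|\}$, linear order $<$, binary successor relation $\mathrm{suc}$, and unary predicates $Q_{\mathtt a}=\{i:w_i=\mathtt a\}$. $\mathrm{FO}^2_{m,n}[<,\mathrm{suc}]$ is the set of first-order formulas over this vocabulary using only variables $x,y$ (which may be requantified) with quantifier depth at most $n$ and such that any path in the parse tree has at most $m$ blocks of alternating quantifiers; $\mathrm{FO}^2_m[<,\mathrm{suc}]=\bigcup_{n\ge m}\mathrm{FO}^2_{m,n}[<,\mathrm{suc}]$. A formula $\varphi$ separates $K,L$ if either all words in $K$ satisfy $\varphi$ and none in $L$ does, or vice versa. -}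

module Defs where

open import Data.Nat using (ℕ; zero; suc; _<_; _≤_; _⊔_)
open import Data.Fin using (Fin)
open import Data.List using (List; []; _∷_; length)
open import Data.Bool using (Bool; true; false)
open import Data.Unit using (⊤)
open import Data.Empty using (⊥)
open import Data.Product using (Σ; _×_; _,_)
open import Data.Sum using (_⊎_)
open import Relation.Nullary using (¬_)
open import Relation.Binary.PropositionalEquality using (_≡_)

data Var : Set where
  vx vy : Var

data QKind : Set where
  ∃k ∀k : QKind

-- FO² formulas over the vocabulary [<, suc, (Q_a)_{a ∈ Σ}] with
-- alphabet Σ = Fin k, in negation normal form (negations only on atoms).
data Formula (k : ℕ) : Set where
  tt ff            : Formula k
  lt nlt           : Var → Var → Formula k
  sc nsc           : Var → Var → Formula k
  eq neq           : Var → Var → Formula k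
  lab nlab         : Fin k → Var → Formula k
  _∧ᶠ_ _∨ᶠ_        : Formula k → Formula k → Formula k
  ex all           : Var → Formula k → Formula k

-- Number of blocks of quantifiers along a path, given the kind of the
-- nearest enclosing quantifier (nothing = none above).
data Above : Set where
  none : Above
  q    : QKind → Above

newBlock : Above → QKind → ℕ
newBlock none _ = 1
newBlock (q ∃k) ∃k = 0
newBlock (q ∃k) ∀k = 1
newBlock (q ∀k) ∃k = 1
newBlock (q ∀k) ∀k = 0

blocksFrom : ∀ {k} → Above → Formula k → ℕ
blocksFrom a (φ ∧ᶠ ψ) = blocksFrom a φ ⊔ blocksFrom a ψ
blocksFrom a (φ ∨ᶠ ψ) = blocksFrom a φ ⊔ blocksFrom a ψ
blocksFrom a (ex _ φ)  = newBlock a ∃k Data.Nat.+ blocksFrom (q ∃k) φ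
blocksFrom a (all _ φ) = newBlock a ∀k Data.Nat.+ blocksFrom (q ∀k) φ
blocksFrom a _ = 0

blocks : ∀ {k} → Formula k → ℕ
blocks = blocksFrom none

-- Quantifier depth (unconstrained in FO²_m = ⋃_n FO²_{m,n}; given for reference).
qdepth : ∀ {k} → Formula k → ℕ
qdepth (φ ∧ᶠ ψ) = qdepth φ ⊔ qdepth ψ
qdepth (φ ∨ᶠ ψ) = qdepth φ ⊔ qdepth ψ
qdepth (ex _ φ) = suc (qdepth φ)
qdepth (all _ φ) = suc (qdepth φ)
qdepth _ = 0

InFO2 : ∀ {k} → ℕ → Formula k → Set
InFO2 m φ = blocks φ ≤ m

bound : Bool → Bool → Var → Set
bound bx _ vx = bx ≡ true
bound _ by vy = by ≡ true

closedIn : ∀ {k} → Bool → Bool → Formula k → Set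
closedIn bx by tt = ⊤
closedIn bx by ff = ⊤
closedIn bx by (lt u v)  = bound bx by u × bound bx by v
closedIn bx by (nlt u v) = bound bx by u × bound bx by v
closedIn bx by (sc u v)  = bound bx by u × bound bx by v
closedIn bx by (nsc u v) = bound bx by u × bound bx by v
closedIn bx by (eq u v)  = bound bx by u × bound bx by v
closedIn bx by (neq u v) = bound bx by u × bound bx by v
closedIn bx by (lab _ u)  = bound bx by u
closedIn bx by (nlab _ u) = bound bx by u
closedIn bx by (φ ∧ᶠ ψ) = closedIn bx by φ × closedIn bx by ψ
closedIn bx by (φ ∨ᶠ ψ) = closedIn bx by φ × closedIn bx by ψ
closedIn bx by (ex vx φ)  = closedIn true by φ
closedIn bx by (ex vy φ)  = closedIn bx true φ
closedIn bx by (all vx φ) = closedIn true by φ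
closedIn bx by (all vy φ) = closedIn bx true φ

Sentence : ∀ {k} → Formula k → Set
Sentence = closedIn false false

-- Words over Σ = Fin k; positions are 0,…,|w|-1 (0-indexed version of 1,…,|w|).
Word : ℕ → Set
Word k = List (Fin k)

Language : ℕ → Set₁
Language k = Word k → Set

letterAt : ∀ {k} → Word k → ℕ → Fin k → Set
letterAt [] _ _ = ⊥
letterAt (b ∷ w) zero a = b ≡ a
letterAt (b ∷ w) (suc i) a = letterAt w i a

record Val : Set where
  constructor ⟨_,_⟩
  field
    valx valy : ℕ

get : Val → Var → ℕ
get ⟨ i , j ⟩ vx = i
get ⟨ i , j ⟩ vy = j

set : Val → Var → ℕ → Val
set ⟨ i , j ⟩ vx n = ⟨ n , j ⟩
set ⟨ i , j ⟩ vy n = ⟨ i , n ⟩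

sat : ∀ {k} → Word k → Val → Formula k → Set
sat w ρ tt = ⊤
sat w ρ ff = ⊥
sat w ρ (lt u v)  = get ρ u < get ρ v
sat w ρ (nlt u v) = ¬ (get ρ u < get ρ v)
sat w ρ (sc u v)  = get ρ v ≡ suc (get ρ u)
sat w ρ (nsc u v) = ¬ (get ρ v ≡ suc (get ρ u))
sat w ρ (eq u v)  = get ρ u ≡ get ρ v
sat w ρ (neq u v) = ¬ (get ρ u ≡ get ρ v)
sat w ρ (lab a u)  = letterAt w (get ρ u) a
sat w ρ (nlab a u) = ¬ letterAt w (get ρ u) a
sat w ρ (φ ∧ᶠ ψ) = sat w ρ φ × sat w ρ ψ
sat w ρ (φ ∨ᶠ ψ) = sat w ρ φ ⊎ sat w ρ ψ
sat w ρ (ex v φ)  = Σ ℕ λ i → i < length w × sat w (set ρ v i) φ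
sat w ρ (all v φ) = (i : ℕ) → i < length w → sat w (set ρ v i) φ

-- w ⊨ φ for a sentence φ (the initial valuation is irrelevant for sentences).
_⊨_ : ∀ {k} → Word k → Formula k → Set
w ⊨ φ = sat w ⟨ 0 , 0 ⟩ φ

Separates : ∀ {k} → Formula k → Language k → Language k → Set
Separates φ K L =
  ((∀ w → K w → w ⊨ φ) × (∀ w → L w → ¬ (w ⊨ φ)))
  ⊎ ((∀ w → L w → w ⊨ φ) × (∀ w → K w → ¬ (w ⊨ φ)))

{-# OPTIONS --safe #-}

-- Write m = M + 1.  The two words for m are  B_M … B_1 C B′_1 … B′_M.  The outer blocks B_j and B′_j
-- consist of many copies of a list of the letters of all lower levels followed by x_j, resp. preceded
-- by y_j; the core C carries the level-0 letter in one word and is blank in the other.  Every letter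
-- is surrounded by a long run of blanks.
--
-- The positions of level < j are those of level < j + 1 that lie after every such x_j and before every
-- such y_j.  Unfolding this down to the core costs one quantifier alternation per level, so "the
-- level-0 letter occurs in the core" has M + 1 blocks.
--
-- Conversely, with k blocks left the duplicator only has to make sure that both pebbles are at the
-- same place or both have level at most M + 1 − k =: j (the spoiler's pebble being of smaller level, or
-- in the same block B_j or B′_j): jumps outwards are answered identically, and jumps within lower
-- levels are answered in B_j or B′_j, which contain all lower letters.  Each alternation raises j by 1.
-- Successor moves are harmless because the runs of blanks are longer than the quantifier depth n.

module Submission where

open import Defs
open import Data.Bool as Bool using (Bool; true; false; if_then_else_)
open import Data.Empty using (⊥-elim)
open import Data.Fin using (Fin; toℕ; fromℕ<)
open import Data.Fin.Properties using (toℕ-fromℕ<; toℕ-injective)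
open import Data.List using (length; applyUpTo)
open import Data.List.Properties using (length-applyUpTo)
open import Data.Nat
open import Data.Nat.Divisibility using (divides-refl)
open import Data.Nat.DivMod
open import Data.Nat.Properties
open import Data.Nat.Tactic.RingSolver using (solve-∀)
open import Data.Product as Product using (Σ; ∃; _×_; _,_; proj₁; proj₂)
open import Data.Sum as Sum using (_⊎_; inj₁; inj₂; [_,_]′; map₂)
open import Function using (_∘_; _$_; flip)
open import Relation.Nullary using (¬_; Dec; yes; no; does)
open import Relation.Nullary.Decidable using (_×-dec_; _⊎-dec_; ¬?)
open import Relation.Binary.Definitions using (tri<; tri≈; tri>)
open import Relation.Binary.PropositionalEquality

-- The two-pebble game

-- The five cases are the types of a pair of positions that `lt`, `sc` and `eq` can tell apart;
-- `right` and `left` exclude neighbours.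
data SameOrder (i j i′ j′ : ℕ) : Set where
  equal : i ≡ j → i′ ≡ j′ → SameOrder i j i′ j′
  next  : suc i ≡ j → suc i′ ≡ j′ → SameOrder i j i′ j′
  prev  : suc j ≡ i → suc j′ ≡ i′ → SameOrder i j i′ j′
  right : suc i < j → suc i′ < j′ → SameOrder i j i′ j′
  left  : suc j < i → suc j′ < i′ → SameOrder i j i′ j′

module _ {i j i′ j′ : ℕ} where

  sameOrder-flip : SameOrder i j i′ j′ → SameOrder j i j′ i′
  sameOrder-flip (equal p p′) = equal (sym p) (sym p′)
  sameOrder-flip (next p p′)  = prev p p′
  sameOrder-flip (prev p p′)  = next p p′
  sameOrder-flip (right p p′) = left p p′
  sameOrder-flip (left p p′)  = right p p′

  sameOrder-sym : SameOrder i j i′ j′ → SameOrder i′ j′ i j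
  sameOrder-sym (equal p p′) = equal p′ p
  sameOrder-sym (next p p′)  = next p′ p
  sameOrder-sym (prev p p′)  = prev p′ p
  sameOrder-sym (right p p′) = right p′ p
  sameOrder-sym (left p p′)  = left p′ p

  sameOrder-< : SameOrder i j i′ j′ → i < j → i′ < j′
  sameOrder-< (equal refl _)  i<i = ⊥-elim (<-irrefl refl i<i)
  sameOrder-< (next _ refl)   _   = ≤-refl
  sameOrder-< (prev refl _)   1+j<j = ⊥-elim (<-asym 1+j<j ≤-refl)
  sameOrder-< (right _ p′)    _   = <-trans ≤-refl p′
  sameOrder-< (left p _)      i<j = ⊥-elim (<-asym i<j (<-trans ≤-refl p))

  sameOrder-suc : SameOrder i j i′ j′ → j ≡ suc i → j′ ≡ suc i′
  sameOrder-suc (equal refl _)  i≡1+i = ⊥-elim (1+n≢n (sym i≡1+i))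
  sameOrder-suc (next _ refl)   _     = refl
  sameOrder-suc (prev refl _)   j≡2+j = ⊥-elim (<⇒≢ (<-trans ≤-refl (n<1+n _)) j≡2+j)
  sameOrder-suc (right p _)     refl  = ⊥-elim (<-irrefl refl p)
  sameOrder-suc (left p _)      refl  = ⊥-elim (<-asym p (<-trans ≤-refl ≤-refl))

  sameOrder-≡ : SameOrder i j i′ j′ → i ≡ j → i′ ≡ j′
  sameOrder-≡ (equal _ p′) _ = p′
  sameOrder-≡ (next p _)  refl = ⊥-elim (1+n≢n p)
  sameOrder-≡ (prev p _)  refl = ⊥-elim (1+n≢n p)
  sameOrder-≡ (right p _) refl = ⊥-elim (<-asym p ≤-refl)
  sameOrder-≡ (left p _)  refl = ⊥-elim (<-asym p ≤-refl)

-- In `S c d l r i i′` the spoiler plays in `W c` and the duplicator replies in `W d`; `l` counts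
-- the alternations so far and `r` bounds the moves left.
module Game {k : ℕ} (W : Bool → Word k) (M : ℕ)
  (S : (c d : Bool) (l r i i′ : ℕ) → Set)
  (S-letter : ∀ {c d l r i i′} → S c d l r i i′ → ∀ a → letterAt (W c) i a → letterAt (W d) i′ a)
  (S-letter⁻ : ∀ {c d l r i i′} → S c d l r i i′ → ∀ a → letterAt (W d) i′ a → letterAt (W c) i a)
  (S-weaken : ∀ {c d l r i i′} → S c d l (suc r) i i′ → S c d l r i i′)
  (S-switch : ∀ {c d l r i i′} → suc l < M → S c d l r i i′ → S d c (suc l) r i′ i)
  (S-forth : ∀ {c d l r i i′} → l < M → S c d l (suc r) i i′ → ∀ j → j < length (W c) →
             ∃ λ j′ → j′ < length (W d) × S c d l r j j′ × SameOrder i j i′ j′)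
  where

  record Config (c d : Bool) (l r : ℕ) (ρ ρ′ : Val) : Set where
    constructor config
    field
      at-x  : S c d l r (get ρ vx) (get ρ′ vx)
      at-y  : S c d l r (get ρ vy) (get ρ′ vy)
      order : SameOrder (get ρ vx) (get ρ vy) (get ρ′ vx) (get ρ′ vy)

  open Config

  at : ∀ {c d l r ρ ρ′} → Config c d l r ρ ρ′ → ∀ u → S c d l r (get ρ u) (get ρ′ u)
  at C vx = at-x C
  at C vy = at-y C

  orders : ∀ {c d l r ρ ρ′} → Config c d l r ρ ρ′ →
           ∀ u v → SameOrder (get ρ u) (get ρ v) (get ρ′ u) (get ρ′ v)
  orders C vx vx = equal refl refl
  orders C vx vy = order C
  orders C vy vx = sameOrder-flip (order C)
  orders C vy vy = equal refl refl

  switch : ∀ {c d l r ρ ρ′} → suc l < M → Config c d l r ρ ρ′ → Config d c (suc l) r ρ′ ρ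
  switch l<M C = config (S-switch l<M (at-x C)) (S-switch l<M (at-y C)) (sameOrder-sym (order C))

  forth : ∀ {c d l r ρ ρ′} → l < M → Config c d l (suc r) ρ ρ′ → ∀ v i → i < length (W c) →
          ∃ λ i′ → i′ < length (W d) × Config c d l r (set ρ v i) (set ρ′ v i′)
  forth l<M C vx i i< with S-forth l<M (at-y C) i i<
  ... | i′ , i′< , s , o = i′ , i′< , config s (S-weaken (at-y C)) (sameOrder-flip o)
  forth l<M C vy i i< with S-forth l<M (at-x C) i i<
  ... | i′ , i′< , s , o = i′ , i′< , config (S-weaken (at-x C)) s o

  private
    ⊔≤ˡ : ∀ a b {x} → a ⊔ b ≤ x → a ≤ x
    ⊔≤ˡ a b = m⊔n≤o⇒m≤o a b

    ⊔≤ʳ : ∀ a b {x} → a ⊔ b ≤ x → b ≤ x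
    ⊔≤ʳ a b = m⊔n≤o⇒n≤o a b

    ⊔+≤ˡ : ∀ a b {l x} → (a ⊔ b) + l ≤ x → a + l ≤ x
    ⊔+≤ˡ a b {l} = ≤-trans (+-monoˡ-≤ l (m≤m⊔n a b))

    ⊔+≤ʳ : ∀ a b {l x} → (a ⊔ b) + l ≤ x → b + l ≤ x
    ⊔+≤ʳ a b {l} = ≤-trans (+-monoˡ-≤ l (m≤n⊔m a b))

    +≤⇒≤ʳ : ∀ b {l x} → b + l ≤ x → l ≤ x
    +≤⇒≤ʳ b = ≤-trans (m≤n+m _ b)

    1+≤ : ∀ b {l x} → suc b + l ≤ x → b + suc l ≤ x
    1+≤ b {l} {x} = subst (_≤ x) (sym (+-suc b l))

  mutual
    -- Truth passes from the spoiler's word to the other one here, and the other way in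
    -- `transfer-∀`; in both, a quantifier of the current kind is a spoiler move in `W c`. A
    -- quantifier of the other kind opens a new block, hence `switch` and `suc l`.
    transfer-∃ : ∀ ψ {c d l r ρ ρ′} → qdepth ψ ≤ r → blocksFrom (q ∃k) ψ + suc l ≤ M →
                 Config c d l r ρ ρ′ → sat (W c) ρ ψ → sat (W d) ρ′ ψ
    transfer-∃ tt _ _ C p = p
    transfer-∃ (lt u v) _ _ C = sameOrder-< (orders C u v)
    transfer-∃ (nlt u v) _ _ C p = p ∘ sameOrder-< (sameOrder-sym (orders C u v))
    transfer-∃ (sc u v) _ _ C = sameOrder-suc (orders C u v)
    transfer-∃ (nsc u v) _ _ C p = p ∘ sameOrder-suc (sameOrder-sym (orders C u v))
    transfer-∃ (eq u v) _ _ C = sameOrder-≡ (orders C u v)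
    transfer-∃ (neq u v) _ _ C p = p ∘ sameOrder-≡ (sameOrder-sym (orders C u v))
    transfer-∃ (lab a u) _ _ C = S-letter (at C u) a
    transfer-∃ (nlab a u) _ _ C p = p ∘ S-letter⁻ (at C u) a
    transfer-∃ (φ ∧ᶠ ψ) d b C (p , p′) =
      transfer-∃ φ (⊔≤ˡ (qdepth φ) (qdepth ψ) d) (⊔+≤ˡ (blocksFrom (q ∃k) φ) (blocksFrom (q ∃k) ψ) b) C p ,
      transfer-∃ ψ (⊔≤ʳ (qdepth φ) (qdepth ψ) d) (⊔+≤ʳ (blocksFrom (q ∃k) φ) (blocksFrom (q ∃k) ψ) b) C p′
    transfer-∃ (φ ∨ᶠ ψ) d b C (inj₁ p) =
      inj₁ (transfer-∃ φ (⊔≤ˡ (qdepth φ) (qdepth ψ) d) (⊔+≤ˡ (blocksFrom (q ∃k) φ) (blocksFrom (q ∃k) ψ) b) C p)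
    transfer-∃ (φ ∨ᶠ ψ) d b C (inj₂ p) =
      inj₂ (transfer-∃ ψ (⊔≤ʳ (qdepth φ) (qdepth ψ) d) (⊔+≤ʳ (blocksFrom (q ∃k) φ) (blocksFrom (q ∃k) ψ) b) C p)
    transfer-∃ (ex v φ) (s≤s d) b C (i , i< , p) with forth (+≤⇒≤ʳ (blocksFrom (q ∃k) φ) b) C v i i<
    ... | i′ , i′< , C′ = i′ , i′< , transfer-∃ φ d b C′ p
    transfer-∃ (all v φ) (s≤s d) b C p i i< = step (1+≤ (blocksFrom (q ∀k) φ) b)
      where
      step : blocksFrom (q ∀k) φ + suc (suc _) ≤ M → _
      step b′ with forth (+≤⇒≤ʳ (blocksFrom (q ∀k) φ) b′) (switch (+≤⇒≤ʳ (blocksFrom (q ∀k) φ) b′) C) v i i<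
      ... | i′ , i′< , C′ = transfer-∀ φ d b′ C′ (p i′ i′<)

    transfer-∀ : ∀ ψ {c d l r ρ ρ′} → qdepth ψ ≤ r → blocksFrom (q ∀k) ψ + suc l ≤ M →
                 Config c d l r ρ ρ′ → sat (W d) ρ′ ψ → sat (W c) ρ ψ
    transfer-∀ tt _ _ C p = p
    transfer-∀ (lt u v) _ _ C = sameOrder-< (sameOrder-sym (orders C u v))
    transfer-∀ (nlt u v) _ _ C p = p ∘ sameOrder-< (orders C u v)
    transfer-∀ (sc u v) _ _ C = sameOrder-suc (sameOrder-sym (orders C u v))
    transfer-∀ (nsc u v) _ _ C p = p ∘ sameOrder-suc (orders C u v)
    transfer-∀ (eq u v) _ _ C = sameOrder-≡ (sameOrder-sym (orders C u v))
    transfer-∀ (neq u v) _ _ C p = p ∘ sameOrder-≡ (orders C u v)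
    transfer-∀ (lab a u) _ _ C = S-letter⁻ (at C u) a
    transfer-∀ (nlab a u) _ _ C p = p ∘ S-letter (at C u) a
    transfer-∀ (φ ∧ᶠ ψ) d b C (p , p′) =
      transfer-∀ φ (⊔≤ˡ (qdepth φ) (qdepth ψ) d) (⊔+≤ˡ (blocksFrom (q ∀k) φ) (blocksFrom (q ∀k) ψ) b) C p ,
      transfer-∀ ψ (⊔≤ʳ (qdepth φ) (qdepth ψ) d) (⊔+≤ʳ (blocksFrom (q ∀k) φ) (blocksFrom (q ∀k) ψ) b) C p′
    transfer-∀ (φ ∨ᶠ ψ) d b C (inj₁ p) =
      inj₁ (transfer-∀ φ (⊔≤ˡ (qdepth φ) (qdepth ψ) d) (⊔+≤ˡ (blocksFrom (q ∀k) φ) (blocksFrom (q ∀k) ψ) b) C p)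
    transfer-∀ (φ ∨ᶠ ψ) d b C (inj₂ p) =
      inj₂ (transfer-∀ ψ (⊔≤ʳ (qdepth φ) (qdepth ψ) d) (⊔+≤ʳ (blocksFrom (q ∀k) φ) (blocksFrom (q ∀k) ψ) b) C p)
    transfer-∀ (all v φ) (s≤s d) b C p i i< with forth (+≤⇒≤ʳ (blocksFrom (q ∀k) φ) b) C v i i<
    ... | i′ , i′< , C′ = transfer-∀ φ d b C′ (p i′ i′<)
    transfer-∀ (ex v φ) (s≤s d) b C (i , i< , p) = step (1+≤ (blocksFrom (q ∃k) φ) b)
      where
      step : blocksFrom (q ∃k) φ + suc (suc _) ≤ M → _
      step b′ with forth (+≤⇒≤ʳ (blocksFrom (q ∃k) φ) b′) (switch (+≤⇒≤ʳ (blocksFrom (q ∃k) φ) b′) C) v i i<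
      ... | i′ , i′< , C′ = i′ , i′< , transfer-∃ φ d b′ C′ p

  -- The outermost quantifier may be of either kind and is not yet an alternation, so both
  -- orientations are assumed at `l = 0`.
  transfer : ∀ ψ {c d r ρ ρ′} → qdepth ψ ≤ r → blocks ψ ≤ M →
             Config c d 0 r ρ ρ′ → Config d c 0 r ρ′ ρ → sat (W c) ρ ψ → sat (W d) ρ′ ψ
  transfer tt _ _ C _ p = p
  transfer (lt u v) _ _ C _ = sameOrder-< (orders C u v)
  transfer (nlt u v) _ _ C _ p = p ∘ sameOrder-< (sameOrder-sym (orders C u v))
  transfer (sc u v) _ _ C _ = sameOrder-suc (orders C u v)
  transfer (nsc u v) _ _ C _ p = p ∘ sameOrder-suc (sameOrder-sym (orders C u v))
  transfer (eq u v) _ _ C _ = sameOrder-≡ (orders C u v)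
  transfer (neq u v) _ _ C _ p = p ∘ sameOrder-≡ (sameOrder-sym (orders C u v))
  transfer (lab a u) _ _ C _ = S-letter (at C u) a
  transfer (nlab a u) _ _ C _ p = p ∘ S-letter⁻ (at C u) a
  transfer (φ ∧ᶠ ψ) d b C C′ (p , p′) =
    transfer φ (⊔≤ˡ (qdepth φ) (qdepth ψ) d) (⊔≤ˡ (blocks φ) (blocks ψ) b) C C′ p ,
    transfer ψ (⊔≤ʳ (qdepth φ) (qdepth ψ) d) (⊔≤ʳ (blocks φ) (blocks ψ) b) C C′ p′
  transfer (φ ∨ᶠ ψ) d b C C′ (inj₁ p) =
    inj₁ (transfer φ (⊔≤ˡ (qdepth φ) (qdepth ψ) d) (⊔≤ˡ (blocks φ) (blocks ψ) b) C C′ p)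
  transfer (φ ∨ᶠ ψ) d b C C′ (inj₂ p) =
    inj₂ (transfer ψ (⊔≤ʳ (qdepth φ) (qdepth ψ) d) (⊔≤ʳ (blocks φ) (blocks ψ) b) C C′ p)
  transfer (ex v φ) d b C _ =
    transfer-∃ (ex v φ) d (subst (_≤ M) (+-comm 1 (blocksFrom (q ∃k) φ)) b) C
  transfer (all v φ) d b _ C′ =
    transfer-∀ (all v φ) d (subst (_≤ M) (+-comm 1 (blocksFrom (q ∀k) φ)) b) C′

-- The duplicator's answer to a jump in one direction

-- With ≺ the direction of the jump, B and B′ the two blocks of the current level in this order, back
-- and far are limits near their outer ends, inner is one near the inner end of B, and edge is the
-- inner end of B itself.
Side : (_≺_ _≼_ : ℕ → ℕ → Set) (far back inner edge i i′ : ℕ) → Set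
Side _≺_ _≼_ far back inner edge i i′ =
  (i′ ≺ far) × ((edge ≼ i) ⊎ ((back ≼ i) × (i′ ≺ inner)))

-- Stated for an abstract order so that it applies to jumps to the right and, reversed, to jumps
-- to the left.  Unprimed thresholds are those after the move, primed ones those before it.
module Jump (_≺_ _≼_ : ℕ → ℕ → Set)
  (≺-trans : ∀ {x y z} → x ≺ y → y ≺ z → x ≺ z)
  (≺-≼-trans : ∀ {x y z} → x ≺ y → y ≼ z → x ≺ z)
  (≼-≺-trans : ∀ {x y z} → x ≼ y → y ≺ z → x ≺ z)
  (≺⇒≼ : ∀ {x y} → x ≺ y → x ≼ y)
  (≺-irrefl : ∀ {x} → ¬ (x ≺ x))
  (compare : ∀ x y → (x ≺ y) ⊎ (y ≼ x))
  (RO RO′ LE LE′ LO LO′ LI LI′ RI RE : ℕ)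
  (RO′≺RO : RO′ ≺ RO) (LE≺LE′ : LE ≺ LE′) (LO≺LO′ : LO ≺ LO′)
  (LO≺RO′ : LO ≺ RO′) (LO≺LI′ : LO ≺ LI′) (LI≺RO : LI ≺ RO) (RI≺RO′ : RI ≺ RO′)
  (LE≼RE : LE ≼ RE)
  (len : ℕ) (E : ℕ → ℕ → Set)
  (find-far  : ∀ j → LE ≼ j → j ≺ RO → ∃ λ j′ → j′ < len × E j j′ × (RO′ ≺ j′) × (j′ ≺ RO))
  (find-near : ∀ j → LO ≼ j → j ≺ LE → ∃ λ j′ → j′ < len × E j j′ × (LI′ ≺ j′) × (j′ ≺ LI))
  (beyond : ∀ j → RO ≼ j → E j j)
  (core : ∀ j → E j j ⊎ ((LE ≼ j) × (j ≺ RO′)))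
  where

  Fore Back : ℕ → ℕ → Set
  Fore = Side _≺_ _≼_ RO LO LI LE
  Back = Side (flip _≺_) (flip _≼_) LO RO RI RE

  Zone : ℕ → ℕ → Set
  Zone j j′ = j ≡ j′ ⊎ (Fore j j′ × Back j j′)

  -- The intermediate point `z` says in terms of `≺` alone that the reply is not a neighbour of
  -- `i′`, so one statement serves both directions.
  Answer : (i′ j : ℕ) → Set
  Answer i′ j = ∃ λ j′ → j′ < len × E j j′ × Zone j j′ × (∃ λ z → (i′ ≺ z) × (z ≺ j′))

  jump-far : ∀ {i′ j} → i′ ≺ RO′ → LE ≼ j → j ≺ RO → Answer i′ j
  jump-far {j = j} i′≺RO′ LE≼j j≺RO with find-far j LE≼j j≺RO
  ... | j′ , j′<len , e , RO′≺j′ , j′≺RO =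
    j′ , j′<len , e ,
    inj₂ ((j′≺RO , inj₁ LE≼j) , (≺-trans LO≺RO′ RO′≺j′ , inj₂ (≺⇒≼ j≺RO , ≺-trans RI≺RO′ RO′≺j′))) ,
    RO′ , i′≺RO′ , RO′≺j′

  -- A jump past `RO` is copied, and from equal positions so is one outside the core. A landing
  -- point between `LE` and `RO` is otherwise answered in the far block. A jump that stays in the
  -- near block is answered there, since the boundary letter of that block is missing from the far
  -- one.
  jump : ∀ {i i′ j z} → i ≡ i′ ⊎ Side _≺_ _≼_ RO′ LO′ LI′ LE′ i i′ →
         i ≺ z → z ≺ j → j < len → Answer i′ j
  jump {i} {j = j} {z = z} (inj₁ refl) i≺z z≺j j<len with core j
  ... | inj₁ e = j , j<len , e , inj₁ refl , z , i≺z , z≺j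
  ... | inj₂ (LE≼j , j≺RO′) =
    jump-far (≺-trans (≺-trans i≺z z≺j) j≺RO′) LE≼j (≺-trans j≺RO′ RO′≺RO)
  jump {i} {i′} {j} {z} (inj₂ (i′≺RO′ , s)) i≺z z≺j j<len with compare j RO
  ... | inj₂ RO≼j = j , j<len , beyond j RO≼j , inj₁ refl , RO′ , i′≺RO′ , ≺-≼-trans RO′≺RO RO≼j
  ... | inj₁ j≺RO with compare j LE
  ...   | inj₂ LE≼j = jump-far i′≺RO′ LE≼j j≺RO
  ...   | inj₁ j≺LE = near s
    where
    near : (LE′ ≼ i) ⊎ ((LO′ ≼ i) × (i′ ≺ LI′)) → Answer i′ j
    near (inj₁ LE′≼i) = ⊥-elim (≺-irrefl (≺-trans LE≺LE′ (≼-≺-trans LE′≼i (≺-trans (≺-trans i≺z z≺j) j≺LE))))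
    near (inj₂ (LO′≼i , i′≺LI′)) with LO≺j ← ≺-trans LO≺LO′ (≼-≺-trans LO′≼i (≺-trans i≺z z≺j))
                                 | find-near j (≺⇒≼ LO≺j) j≺LE
    ... | j′ , j′<len , e , LI′≺j′ , j′≺LI =
      j′ , j′<len , e ,
      inj₂ ((≺-trans j′≺LI LI≺RO , inj₂ (≺⇒≼ LO≺j , j′≺LI)) ,
            (≺-trans LO≺LI′ LI′≺j′ , inj₁ (≺⇒≼ (≺-≼-trans j≺LE LE≼RE)))) ,
      LI′ , i′≺LI′ , LI′≺j′

-- Arithmetic of mixed-radix positions

[r+kd]/d≡k : ∀ {r d} k .{{_ : NonZero d}} → r < d → (r + k * d) / d ≡ k
[r+kd]/d≡k {r} {d} k r<d = begin
  (r + k * d) / d      ≡⟨ +-distrib-/-∣ʳ r (divides-refl k) ⟩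
  r / d + (k * d) / d  ≡⟨ cong₂ _+_ (m<n⇒m/n≡0 r<d) (m*n/n≡m k d) ⟩
  k                    ∎
  where open ≡-Reasoning

[r+kd]%d≡r : ∀ {r d} k .{{_ : NonZero d}} → r < d → (r + k * d) % d ≡ r
[r+kd]%d≡r {r} {d} k r<d = trans ([m+kn]%n≡m%n r k d) (m<n⇒m%n≡m r<d)

digit-< : ∀ {r d k l} → r < d → k < l → r + k * d < l * d
digit-< {d = d} {k} r<d k<l = ≤-trans (+-monoˡ-≤ (k * d) r<d) (*-monoˡ-≤ d k<l)

m*o≤n⇒m≤n/o : ∀ {m n} o .{{_ : NonZero o}} → m * o ≤ n → m ≤ n / o
m*o≤n⇒m≤n/o {m} o mo≤n = subst (_≤ _) (m*n/n≡m m o) (/-monoˡ-≤ o mo≤n)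

letterAt-applyUpTo⁺ : ∀ {k} (f : ℕ → Fin k) n i → i < n → letterAt (applyUpTo f n) i (f i)
letterAt-applyUpTo⁺ f (suc n) zero    _         = refl
letterAt-applyUpTo⁺ f (suc n) (suc i) (s≤s i<n) = letterAt-applyUpTo⁺ (f ∘ suc) n i i<n

letterAt-applyUpTo⁻ : ∀ {k} (f : ℕ → Fin k) n i a → letterAt (applyUpTo f n) i a → f i ≡ a
letterAt-applyUpTo⁻ f (suc n) zero    a p = p
letterAt-applyUpTo⁻ f (suc n) (suc i) a p = letterAt-applyUpTo⁻ (f ∘ suc) n i a p

-- Block and boundary letter are mirror images about `M`, so they have the same level.
∣s-M∣≡∣b-M∣ : ∀ s b M → s + b ≡ M + M → ∣ s - M ∣ ≡ ∣ b - M ∣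
∣s-M∣≡∣b-M∣ s b M s+b≡2M = begin
  ∣ s - M ∣              ≡⟨ ∣m+n-m+o∣≡∣n-o∣ b s M ⟨
  ∣ b + s - (b + M) ∣    ≡⟨ cong₂ ∣_-_∣ (trans (+-comm b s) s+b≡2M) (+-comm b M) ⟩
  ∣ M + M - (M + b) ∣    ≡⟨ ∣m+n-m+o∣≡∣n-o∣ M M b ⟩
  ∣ M - b ∣              ≡⟨ ∣-∣-comm M b ⟩
  ∣ b - M ∣              ∎
  where open ≡-Reasoning

∣m-n∣<o : ∀ {m n o} → m < n + o → n < m + o → ∣ m - n ∣ < o
∣m-n∣<o {m} {n} {o@(suc _)} m<n+o n<m+o with ≤-total m n
... | inj₁ m≤n rewrite m≤n⇒∣m-n∣≡n∸m m≤n = m<n+o⇒m∸n<o n m n<m+o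
... | inj₂ n≤m rewrite m≤n⇒∣n-m∣≡n∸m n≤m = m<n+o⇒m∸n<o m n m<n+o
∣m-n∣<o {m} {n} {zero} m<n+0 n<m+0 =
  ⊥-elim (<-asym (subst (m <_) (+-identityʳ n) m<n+0) (subst (n <_) (+-identityʳ m) n<m+0))

if-cases : ∀ {p} {X : Set p} (X? : Dec X) {x y : ℕ} →
           ((if does X? then x else y) ≡ x × X) ⊎ ((if does X? then x else y) ≡ y × ¬ X)
if-cases (yes p) = inj₁ (refl , p)
if-cases (no ¬p) = inj₂ (refl , ¬p)

-- Letters and the blocks that may carry them

module Letters (M : ℕ) where

  top blank Q : ℕ
  top   = M + M
  blank = suc top
  Q     = suc blank

  -- Blocks and letters are numbered 0, …, 2M from left to right, resp. from y_M over the level-0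
  -- letter to x_M: block b has level ∣ b - M ∣ and boundary letter 2M − b.  This order of the letters
  -- puts x_j last and y_j first in its group.  Only the word with c = true has letters in the core.
  Allowed : Bool → ℕ → ℕ → Set
  Allowed c b s = (s + b ≡ top ⊎ ∣ s - M ∣ < ∣ b - M ∣) × (c ≡ true ⊎ b ≢ M)

  allowed? : ∀ c b s → Dec (Allowed c b s)
  allowed? c b s = (s + b ≟ top ⊎-dec ∣ s - M ∣ <? ∣ b - M ∣) ×-dec (c Bool.≟ true ⊎-dec ¬? (b ≟ M))

  abstract
    letter : Bool → ℕ → ℕ → ℕ
    letter c b s = if does (allowed? c b s) then s else blank

    letter-cases : ∀ c b s → (letter c b s ≡ s × Allowed c b s) ⊎ (letter c b s ≡ blank × ¬ Allowed c b s)
    letter-cases c b s = if-cases (allowed? c b s)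

  letter-allowed : ∀ {c b s} → Allowed c b s → letter c b s ≡ s
  letter-allowed {c} {b} {s} p = [ proj₁ , ⊥-elim ∘ (_$ p) ∘ proj₂ ]′ (letter-cases c b s)

  letter-blank : ∀ c b → letter c b blank ≡ blank
  letter-blank c b = [ proj₁ , proj₁ ]′ (letter-cases c b blank)

  letter-< : ∀ c b {s} → s < Q → letter c b s < Q
  letter-< c b {s} s<Q with letter-cases c b s
  ... | inj₁ (e , _) = subst (_< Q) (sym e) s<Q
  ... | inj₂ (e , _) = subst (_< Q) (sym e) ≤-refl

  letter-side : ∀ c d {b} s → b ≢ M → letter c b s ≡ letter d b s
  letter-side c d {b} s b≢M with letter-cases c b s | letter-cases d b s
  ... | inj₁ (e , _)       | inj₁ (e′ , _)       = trans e (sym e′)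
  ... | inj₁ (_ , p , _)   | inj₂ (_ , ¬p)       = ⊥-elim (¬p (p , inj₂ b≢M))
  ... | inj₂ (_ , ¬p)      | inj₁ (_ , p , _)    = ⊥-elim (¬p (p , inj₂ b≢M))
  ... | inj₂ (e , _)       | inj₂ (e′ , _)       = trans e (sym e′)

  -- A boundary letter has the level of its block, so every letter of `b` is a lower-level letter
  -- for a block `b′` of larger level. Since `b′` is not the core, it carries the same letters in
  -- both words.
  letter-inherit : ∀ c d {b b′} s → b′ ≢ M → b ≡ b′ ⊎ ∣ b - M ∣ < ∣ b′ - M ∣ →
                   letter d b′ (letter c b s) ≡ letter c b s
  letter-inherit c d {b} {b′} s b′≢M b→b′ with letter-cases c b s
  ... | inj₂ (e , _) = begin
    letter d b′ (letter c b s)  ≡⟨ cong (letter d b′) e ⟩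
    letter d b′ blank           ≡⟨ letter-blank d b′ ⟩
    blank                       ≡⟨ e ⟨
    letter c b s                ∎
    where open ≡-Reasoning
  ... | inj₁ (e , p , _) = begin
    letter d b′ (letter c b s)  ≡⟨ cong (letter d b′) e ⟩
    letter d b′ s               ≡⟨ letter-allowed {d} {b′} {s} (allow p b→b′ , inj₂ b′≢M) ⟩
    s                           ≡⟨ e ⟨
    letter c b s                ∎
    where
    open ≡-Reasoning
    allow : s + b ≡ top ⊎ ∣ s - M ∣ < ∣ b - M ∣ → b ≡ b′ ⊎ ∣ b - M ∣ < ∣ b′ - M ∣ →
            s + b′ ≡ top ⊎ ∣ s - M ∣ < ∣ b′ - M ∣
    allow p        (inj₁ refl) = p
    allow (inj₁ p) (inj₂ b<b′) = inj₂ (subst (_< ∣ b′ - M ∣) (sym (∣s-M∣≡∣b-M∣ s b M p)) b<b′)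
    allow (inj₂ p) (inj₂ b<b′) = inj₂ (<-trans p b<b′)

-- The pair of words for runs of length governed by `n`

module Words (M n : ℕ) where

  open Letters M

  -- Mixed-radix layout: position o + (s + (g + b * N) * Q) * T is offset o in the tile of slot s in
  -- group g of block b.  A tile has T symbols, all blank except possibly the one at offset P.
  P T A N : ℕ
  P = suc n
  T = suc (P + P)
  A = 4 + (n + n)
  N = 2 + (A + (n + n))

  base : ℕ → ℕ
  base g = g * Q * T

  len : ℕ
  len = base (suc top * N)

  block : ℕ → ℕ
  block i = i / T / Q / N

  tile : Bool → ℕ → ℕ
  tile c t = letter c (t / Q / N) (t % Q)

  symbol : Bool → ℕ → ℕ
  symbol c i = if does (i % T ≟ P) then tile c (i / T) else blank

  tile-< : ∀ c t → tile c t < Q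
  tile-< c t = letter-< c (t / Q / N) (m%n<n t Q)

  symbol-< : ∀ c i → symbol c i < Q
  symbol-< c i with if-cases (i % T ≟ P) {tile c (i / T)} {blank}
  ... | inj₁ (e , _) = subst (_< Q) (sym e) (tile-< c (i / T))
  ... | inj₂ (e , _) = subst (_< Q) (sym e) ≤-refl

  word : Bool → Word Q
  word c = applyUpTo (λ i → fromℕ< (symbol-< c i)) len

  length-word : ∀ c → length (word c) ≡ len
  length-word c = length-applyUpTo (λ i → fromℕ< (symbol-< c i)) len

  letterAt-word⁺ : ∀ c i a → i < len → symbol c i ≡ toℕ a → letterAt (word c) i a
  letterAt-word⁺ c i a i<len e =
    subst (letterAt (word c) i)
          (toℕ-injective (trans (toℕ-fromℕ< (symbol-< c i)) e))
          (letterAt-applyUpTo⁺ (λ i → fromℕ< (symbol-< c i)) len i i<len)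

  letterAt-word⁻ : ∀ c i a → letterAt (word c) i a → symbol c i ≡ toℕ a
  letterAt-word⁻ c i a p =
    trans (sym (toℕ-fromℕ< (symbol-< c i)))
          (cong toℕ (letterAt-applyUpTo⁻ (λ i → fromℕ< (symbol-< c i)) len i a p))

  symbol-cases : ∀ c {o} t → o < T →
                 (symbol c (o + t * T) ≡ tile c t × o ≡ P) ⊎ (symbol c (o + t * T) ≡ blank × o ≢ P)
  symbol-cases c {o} t o<T
    rewrite [r+kd]%d≡r {o} {T} t o<T | [r+kd]/d≡k {o} {T} t o<T = if-cases (o ≟ P)

  symbol-centre : ∀ c t → symbol c (P + t * T) ≡ tile c t
  symbol-centre c t = [ proj₁ , ⊥-elim ∘ (_$ refl) ∘ proj₂ ]′ (symbol-cases c t (s≤s (m≤m+n P P)))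

  symbol-nonblank : ∀ c i {a} → symbol c i ≡ a → a ≢ blank →
                    i ≡ P + i / T * T × tile c (i / T) ≡ a
  symbol-nonblank c i e a≢blank with if-cases (i % T ≟ P) {tile c (i / T)} {blank}
  ... | inj₁ (e′ , o≡P) = trans (m≡m%n+[m/n]*n i T) (cong (_+ i / T * T) o≡P) , trans (sym e′) e
  ... | inj₂ (e′ , _)   = ⊥-elim (a≢blank (trans (sym e) e′))

  tile-slot : ∀ c {g s b} → g < N → s < Q → tile c (s + (g + b * N) * Q) ≡ letter c b s
  tile-slot c {g} {s} {b} g<N s<Q
    rewrite [r+kd]%d≡r {s} {Q} (g + b * N) s<Q | [r+kd]/d≡k {s} {Q} (g + b * N) s<Q
          | [r+kd]/d≡k {g} {N} b g<N = refl

  block-slot : ∀ {o g s b} → o < T → g < N → s < Q → block (o + (s + (g + b * N) * Q) * T) ≡ b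
  block-slot {o} {g} {s} {b} o<T g<N s<Q
    rewrite [r+kd]/d≡k {o} {T} (s + (g + b * N) * Q) o<T | [r+kd]/d≡k {s} {Q} (g + b * N) s<Q
          | [r+kd]/d≡k {g} {N} b g<N = refl

  block-mono : ∀ {i j} → i ≤ j → block i ≤ block j
  block-mono i≤j = /-monoˡ-≤ N (/-monoˡ-≤ Q (/-monoˡ-≤ T i≤j))

  block-≥ : ∀ {i} b → base (b * N) ≤ i → b ≤ block i
  block-≥ b p = m*o≤n⇒m≤n/o N (m*o≤n⇒m≤n/o Q (m*o≤n⇒m≤n/o T p))

  block-< : ∀ {i} b → i < base (b * N) → block i < b
  block-< b p = m<n*o⇒m/o<n (m<n*o⇒m/o<n (m<n*o⇒m/o<n p))

  base-mono-< : ∀ {g h} → g < h → base g < base h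
  base-mono-< g<h = *-monoˡ-< T (*-monoˡ-< Q g<h)

  base-mono-≤ : ∀ {g h} → g ≤ h → base g ≤ base h
  base-mono-≤ g≤h = *-monoˡ-≤ T (*-monoˡ-≤ Q g≤h)

  slot-≥ : ∀ o s g → base g ≤ o + (s + g * Q) * T
  slot-≥ o s g = ≤-trans (*-monoˡ-≤ T (m≤n+m (g * Q) s)) (m≤n+m _ o)

  slot-< : ∀ {o s g} → o < T → s < Q → o + (s + g * Q) * T < base (suc g)
  slot-< {g = g} o<T s<Q = digit-< o<T (digit-< {k = g} s<Q ≤-refl)

  -- The duplicator's strategy

  -- Within r steps a pebble at a far offset cannot reach the letter of a tile.
  Far : ℕ → ℕ → Set
  Far r o = o + r < P ⊎ P + r < o

  far-weaken : ∀ {r} o → Far (suc r) o → Far r o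
  far-weaken {r} o (inj₁ p) = inj₁ (≤-trans (s≤s (+-monoʳ-≤ o (n≤1+n r))) p)
  far-weaken {r} o (inj₂ p) = inj₂ (≤-trans (s≤s (+-monoʳ-≤ P (n≤1+n r))) p)

  far-suc : ∀ {r} o → Far (suc r) o → Far r (suc o)
  far-suc {r} o (inj₁ p) = inj₁ (subst (_< P) (+-suc o r) p)
  far-suc {r} o (inj₂ p) = inj₂ (<-trans (subst (P + r <_) (sym (+-suc P r)) ≤-refl) (m<n⇒m<1+n p))

  far-pred : ∀ {r} o → Far (suc r) (suc o) → Far r o
  far-pred {r} o (inj₁ p) = inj₁ (<-trans (s≤s (+-monoʳ-≤ o (n≤1+n r))) p)
  far-pred {r} o (inj₂ p) = inj₂ (s<s⁻¹ (subst (_< suc o) (+-suc P r) p))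

  -- Equal offsets keep the pebbles in step under successor moves; the contents of the tiles have to
  -- agree only if the centre is still within reach.
  record Alike (c d : Bool) (r i i′ : ℕ) : Set where
    constructor alike
    field
      o t t′ : ℕ
      o<T    : o < T
      i≡     : i ≡ o + t * T
      i′≡    : i′ ≡ o + t′ * T
      near   : tile c t ≡ tile d t′ ⊎ Far r o

  module _ {c d : Bool} where

    alike-sym : ∀ {r i i′} → Alike c d r i i′ → Alike d c r i′ i
    alike-sym (alike o t t′ o<T i≡ i′≡ e) = alike o t′ t o<T i′≡ i≡ ([ inj₁ ∘ sym , inj₂ ]′ e)

    alike-weaken : ∀ {r i i′} → Alike c d (suc r) i i′ → Alike c d r i i′
    alike-weaken (alike o t t′ o<T i≡ i′≡ e) = alike o t t′ o<T i≡ i′≡ (map₂ (far-weaken o) e)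

    -- Crossing into the next tile resets the offset to 0, which is `P` steps away from the centre;
    -- as `r < P`, the contents of the new tiles may differ.
    alike-suc : ∀ {r i i′} → r < P → Alike c d (suc r) i i′ → Alike c d r (suc i) (suc i′)
    alike-suc r<P (alike o t t′ o<T i≡ i′≡ e) with suc o <? T
    ... | yes 1+o<T = alike (suc o) t t′ 1+o<T (cong suc i≡) (cong suc i′≡) (map₂ (far-suc o) e)
    ... | no  1+o≮T = alike 0 (suc t) (suc t′) z<s
                            (trans (cong suc i≡) (cong (_+ t * T) 1+o≡T))
                            (trans (cong suc i′≡) (cong (_+ t′ * T) 1+o≡T)) (inj₂ (inj₁ r<P))
      where
      1+o≡T : suc o ≡ T
      1+o≡T = ≤-antisym o<T (≮⇒≥ 1+o≮T)

    alike-pred : ∀ {r i i′} → r < P → Alike c d (suc r) (suc i) (suc i′) → Alike c d r i i′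
    alike-pred r<P (alike (suc o) t t′ o<T i≡ i′≡ e) =
      alike o t t′ (<-trans ≤-refl o<T) (suc-injective i≡) (suc-injective i′≡) (map₂ (far-pred o) e)
    alike-pred r<P (alike zero (suc t) (suc t′) _ i≡ i′≡ _) =
      alike (P + P) t t′ ≤-refl (suc-injective i≡) (suc-injective i′≡)
            (inj₂ (inj₂ (+-monoʳ-< P r<P)))

    alike-symbol : ∀ {r i i′} → Alike c d r i i′ → symbol c i ≡ symbol d i′
    alike-symbol (alike o t t′ o<T refl refl e) with symbol-cases c t o<T | symbol-cases d t′ o<T
    ... | inj₂ (p , _)    | inj₂ (p′ , _)  = trans p (sym p′)
    ... | inj₁ (p , refl) | inj₁ (p′ , _)  = [ (λ q → trans p (trans q (sym p′))) , ⊥-elim ∘ ¬far ]′ e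
      where
      ¬far : ∀ {r} → ¬ Far r P
      ¬far {r} (inj₁ p) = <⇒≱ p (m≤m+n P r)
      ¬far {r} (inj₂ p) = <⇒≱ p (m≤m+n P r)
    ... | inj₁ (_ , p)    | inj₂ (_ , ¬p)  = ⊥-elim (¬p p)
    ... | inj₂ (_ , ¬p)   | inj₁ (_ , p)   = ⊥-elim (¬p p)

    alike-refl : ∀ {r} i → block i ≢ M → Alike c d r i i
    alike-refl i b≢M = alike (i % T) (i / T) (i / T) (m%n<n i T) (m≡m%n+[m/n]*n i T) (m≡m%n+[m/n]*n i T)
                             (inj₁ (letter-side c d (i / T % Q) b≢M))

    Fits : (b r i : ℕ) → Set
    Fits b r i = letter d b (tile c (i / T)) ≡ tile c (i / T) ⊎ Far r (i % T)

    InGroup : (g b r i : ℕ) → Set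
    InGroup g b r i =
      ∃ λ i′ → i′ < len × Alike c d r i i′ × base (g + b * N) ≤ i′ × i′ < base (suc g + b * N)

    find : ∀ {b g r} i → g < N → b ≤ top → Fits b r i → InGroup g b r i
    find {b} {g} {r} i g<N b≤top fits = go fits
      where
      at-slot : ∀ s → s < Q → tile c (i / T) ≡ letter d b s ⊎ Far r (i % T) → InGroup g b r i
      at-slot s s<Q e =
        i % T + (s + (g + b * N) * Q) * T ,
        <-≤-trans (slot-< {g = g + b * N} (m%n<n i T) s<Q)
                  (base-mono-≤ {suc g + b * N} {suc top * N} (+-mono-≤ g<N (*-monoˡ-≤ N b≤top))) ,
        alike (i % T) (i / T) (s + (g + b * N) * Q) (m%n<n i T) (m≡m%n+[m/n]*n i T) refl
              ([ (λ p → inj₁ (trans p (sym (tile-slot d {g} {s} {b} g<N s<Q)))) , inj₂ ]′ e) ,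
        slot-≥ (i % T) s (g + b * N) ,
        slot-< {g = g + b * N} (m%n<n i T) s<Q
      go : Fits b r i → InGroup g b r i
      -- Slots are numbered by the letter they may carry, so the reply takes the slot named after
      -- the letter; at a far offset the blank slot serves.
      go (inj₁ p) = at-slot (tile c (i / T)) (tile-< c (i / T)) (inj₁ (sym p))
      go (inj₂ p) = at-slot blank ≤-refl (inj₂ p)

    fits-block : ∀ {b r} i → b ≢ M → block i ≡ b ⊎ ∣ block i - M ∣ < ∣ b - M ∣ → Fits b r i
    fits-block i b≢M p = inj₁ (letter-inherit c d (i / T % Q) b≢M p)

-- Limits inside the blocks

module Strategy (M n : ℕ) where

  open Letters M
  open Words M n

  1+[n∸1+r]≡n∸r : ∀ {r} → r < n → n ∸ r ≡ suc (n ∸ suc r)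
  1+[n∸1+r]≡n∸r r<n = +-∸-assoc 1 r<n

  -- The limits recede by two groups per move; the duplicator answers in the group in between.
  loOff hiOff : ℕ → ℕ
  loOff r = 2 + (r + r)
  hiOff r = (n ∸ r) + (n ∸ r) + A

  lo hi : ℕ → ℕ → ℕ
  lo b r = base (loOff r + b * N)
  hi b r = base (hiOff r + b * N)

  loOff-suc : ∀ r → loOff (suc r) ≡ 2 + loOff r
  loOff-suc r = cong (3 +_) (+-suc r r)

  hiOff-suc : ∀ {r} → r < n → hiOff r ≡ 2 + hiOff (suc r)
  hiOff-suc {r} r<n rewrite 1+[n∸1+r]≡n∸r r<n = cong (λ x → suc x + A) (+-suc (n ∸ suc r) (n ∸ suc r))

  -- `A` is the least value of `hiOff` and exceeds `2 + (n + n)`, the value of `loOff` at `n`; hence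
  -- `r` and `r′` may be unrelated.
  loOff<hiOff : ∀ {r} r′ → r ≤ n → loOff r < hiOff r′
  loOff<hiOff r′ r≤n = ≤-trans (≤-trans (s≤s (s≤s (s≤s (+-mono-≤ r≤n r≤n)))) (n≤1+n _)) (m≤n+m A _)

  hiOff<N : ∀ r → 2 + hiOff r ≤ N
  hiOff<N r = s≤s (s≤s (subst (_≤ A + (n + n)) (+-comm A _)
                (+-monoʳ-≤ A (+-mono-≤ (m∸n≤m n r) (m∸n≤m n r)))))

  loOff<N : ∀ {r} → r ≤ n → 2 + loOff r ≤ N
  loOff<N {r} r≤n = ≤-trans (s≤s (s≤s (<⇒≤ (loOff<hiOff r r≤n)))) (hiOff<N r)

  lo-suc : ∀ b r → lo b r < lo b (suc r)
  lo-suc b r = base-mono-< (+-monoˡ-< (b * N) {loOff r} {loOff (suc r)}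
                 (subst (loOff r <_) (sym (loOff-suc r)) (n≤1+n _)))

  hi-suc : ∀ b {r} → r < n → hi b (suc r) < hi b r
  hi-suc b {r} r<n = base-mono-< (+-monoˡ-< (b * N) {hiOff (suc r)} {hiOff r}
                       (subst (hiOff (suc r) <_) (sym (hiOff-suc r<n)) (n≤1+n _)))

  lo<hi : ∀ b {r} r′ → r ≤ n → lo b r < hi b r′
  lo<hi b r′ r≤n = base-mono-< (+-monoˡ-< (b * N) (loOff<hiOff r′ r≤n))

  lo<end : ∀ b {r} → r ≤ n → lo b r < base (suc b * N)
  lo<end b r≤n = base-mono-< (+-monoˡ-< (b * N) (≤-trans (n≤1+n _) (loOff<N r≤n)))

  hi<end : ∀ b r → hi b r < base (suc b * N)
  hi<end b r = base-mono-< (+-monoˡ-< (b * N) (≤-trans (n≤1+n _) (hiOff<N r)))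

  start≤hi : ∀ b r → base (b * N) ≤ hi b r
  start≤hi b r = base-mono-≤ (m≤n+m (b * N) (hiOff r))

  start≤lo : ∀ b r → base (b * N) ≤ lo b r
  start≤lo b r = base-mono-≤ (m≤n+m (b * N) (loOff r))

  blocks-≤ : ∀ {b b′} → b ≤ b′ → base (b * N) ≤ base (b′ * N)
  blocks-≤ b≤b′ = base-mono-≤ (*-monoˡ-≤ N b≤b′)

  base+n<base : ∀ g → base g + n < base (suc g)
  base+n<base g = begin-strict
    base g + n         ≡⟨ +-comm (base g) n ⟩
    n + base g         <⟨ +-monoˡ-< (base g) (≤-trans (s≤s (≤-trans (n≤1+n n) (m≤m+n P P))) (m≤m+n T (blank * T))) ⟩
    Q * T + base g     ≡⟨ *-distribʳ-+ T Q (g * Q) ⟨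
    base (suc g)       ∎
    where open ≤-Reasoning

  block-start : ∀ j → base (block j * N) ≤ j
  block-start j with j <? base (block j * N)
  ... | yes p = ⊥-elim (<-irrefl refl (block-< (block j) p))
  ... | no ¬p = ≮⇒≥ ¬p

  block-end : ∀ j → j < base (suc (block j) * N)
  block-end j with j <? base (suc (block j) * N)
  ... | yes p = p
  ... | no ¬p = ⊥-elim (<-irrefl refl (block-≥ (suc (block j)) (≮⇒≥ ¬p)))

  module _ {c d : Bool} where

    find-lo : ∀ {b r} j → r < n → b ≤ top → Fits {c} {d} b r j →
              ∃ λ j′ → j′ < len × Alike c d r j j′ × lo b r < j′ × j′ < lo b (suc r)
    find-lo {b} {r} j r<n b≤top fits
      with find {c} {d} {b} {suc (loOff r)} j (loOff<N (<⇒≤ r<n)) b≤top fits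
    ... | j′ , j′<len , e , p , p′ =
      j′ , j′<len , e , <-≤-trans (base-mono-< {loOff r + b * N} ≤-refl) p ,
      subst (λ x → j′ < base (x + b * N)) (sym (loOff-suc r)) p′

    find-hi : ∀ {b r} j → r < n → b ≤ top → Fits {c} {d} b r j →
              ∃ λ j′ → j′ < len × Alike c d r j j′ × hi b (suc r) < j′ × j′ < hi b r
    find-hi {b} {r} j r<n b≤top fits
      with find {c} {d} {b} {suc (hiOff (suc r))} j (hiOff<N (suc r)) b≤top fits
    ... | j′ , j′<len , e , p , p′ =
      j′ , j′<len , e , <-≤-trans (base-mono-< {hiOff (suc r) + b * N} ≤-refl) p ,
      subst (λ x → j′ < base (x + b * N)) (sym (hiOff-suc r<n)) p′

  -- Zones for the two blocks of level `suc l`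

  module Level (l : ℕ) (l<M : l < M) where

    L R : ℕ
    L = M ∸ suc l
    R = M + suc l

    -- At `r = n` these are the inner ends of the two blocks. With every move they shift by one
    -- position into the adjoining blanks, to make room for a successor step out of the middle.
    leftEdge rightEdge : ℕ → ℕ
    leftEdge r  = (base (suc L * N) ∸ n) + r
    rightEdge r = base (R * N) + (n ∸ r)

    L+1+l≡M : L + suc l ≡ M
    L+1+l≡M = m∸n+n≡m l<M

    L<M : L < M
    L<M = subst (L <_) L+1+l≡M (m<m+n L z<s)

    M<R : M < R
    M<R = m<m+n M z<s

    L<R : L < R
    L<R = <-trans L<M M<R

    R≤top : R ≤ top
    R≤top = +-monoʳ-≤ M l<M

    L≤top : L ≤ top
    L≤top = ≤-trans (<⇒≤ L<R) R≤top

    ∣L-M∣ : ∣ L - M ∣ ≡ suc l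
    ∣L-M∣ = subst (λ x → ∣ L - x ∣ ≡ suc l) L+1+l≡M (∣m-m+n∣≡n L (suc l))

    ∣R-M∣ : ∣ R - M ∣ ≡ suc l
    ∣R-M∣ = trans (∣-∣-comm R M) (∣m-m+n∣≡n M (suc l))

    inside : ∀ {b} → L < b → b < R → ∣ b - M ∣ < suc l
    inside {b} L<b b<R = ∣m-n∣<o b<R (subst (_< b + suc l) L+1+l≡M (+-monoˡ-< (suc l) L<b))

    before<after : ∀ {x} y → x < N → base (x + L * N) < base (y + R * N)
    before<after y x<N = base-mono-< (≤-trans (digit-< x<N L<R) (m≤n+m (R * N) y))

    n≤end : n ≤ base (suc L * N)
    n≤end = ≤-trans (≤-trans (m≤n+m n _) (<⇒≤ (base+n<base (L * N)))) 
              (base-mono-≤ {suc (L * N)} {suc L * N} (+-monoˡ-≤ (L * N) {1} {N} (s≤s z≤n)))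

    leftEdge≤end : ∀ {r} → r ≤ n → leftEdge r ≤ base (suc L * N)
    leftEdge≤end r≤n = ≤-trans (+-monoʳ-≤ (base (suc L * N) ∸ n) r≤n) (≤-reflexive (m∸n+n≡m n≤end))

    leftEdge≤rightEdge : ∀ {r} → r ≤ n → leftEdge r ≤ rightEdge r
    leftEdge≤rightEdge r≤n = ≤-trans (leftEdge≤end r≤n) (≤-trans (blocks-≤ L<R) (m≤m+n _ _))

    hi<leftEdge : ∀ r → hi L r < leftEdge r
    hi<leftEdge r = ≤-trans (m+n≤o⇒m≤o∸n (suc (hi L r))
      (≤-trans (base+n<base (hiOff r + L * N)) (base-mono-≤ (+-monoˡ-≤ (L * N) (≤-trans (n≤1+n _) (hiOff<N r))))))
      (m≤m+n _ r)

    rightEdge<lo : ∀ r → rightEdge r < lo R r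
    rightEdge<lo r = ≤-<-trans (+-monoʳ-≤ (base (R * N)) (m∸n≤m n r))
      (<-≤-trans (base+n<base (R * N)) (base-mono-≤ (+-monoˡ-≤ (R * N) {1} {loOff r} (s≤s z≤n))))

    -- The tile of `j` ends no later than block `L`, so at most `n ∸ r` of its symbols remain from
    -- `j` on, whereas `P` blanks follow its centre.
    far-left : ∀ {r} j → r ≤ n → leftEdge r ≤ j → j < base (suc L * N) → Far r (j % T)
    far-left {r} j r≤n p p′ = inj₂ (+-cancelʳ-≤ n _ _ (+-cancelʳ-≤ (j / T * T) _ _ (begin
      suc (P + r) + n + j / T * T         ≤⟨ +-monoˡ-≤ (j / T * T) (arith n r) ⟩
      T + r + j / T * T                   ≡⟨ trans (cong (_+ j / T * T) (+-comm T r)) (+-assoc r T (j / T * T)) ⟩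
      r + suc (j / T) * T                 ≤⟨ +-monoʳ-≤ r (*-monoˡ-≤ T (m<n*o⇒m/o<n {j} {suc L * N * Q} {T} p′)) ⟩
      r + base (suc L * N)                ≡⟨ cong (r +_) (m∸n+n≡m n≤end) ⟨
      r + (base (suc L * N) ∸ n + n)      ≡⟨ trans (sym (+-assoc r _ n)) (cong (_+ n) (+-comm r _)) ⟩
      leftEdge r + n                      ≤⟨ +-monoˡ-≤ n p ⟩
      j + n                               ≡⟨ cong (_+ n) (m≡m%n+[m/n]*n j T) ⟩
      j % T + j / T * T + n               ≡⟨ xy+z (j % T) (j / T * T) n ⟩
      j % T + n + j / T * T               ∎)))
      where
      open ≤-Reasoning
      arith : ∀ n r → suc (suc n + r) + n ≤ suc (suc n + suc n) + r
      arith n r = ≤-trans (n≤1+n _) (≤-reflexive (1+arith n r))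
        where
        1+arith : ∀ n r → suc (suc (suc n + r) + n) ≡ suc (suc n + suc n) + r
        1+arith = solve-∀
      xy+z : ∀ x y z → x + y + z ≡ x + z + y
      xy+z = solve-∀

    far-right : ∀ {r} j → r ≤ n → base (R * N) ≤ j → j ≤ rightEdge r → Far r (j % T)
    far-right {r} j r≤n p p′ = inj₁ (s≤s (≤-trans (+-monoˡ-≤ r o≤n∸r) (≤-reflexive (m∸n+n≡m r≤n))))
      where
      open ≤-Reasoning
      o≤n∸r : j % T ≤ n ∸ r
      o≤n∸r = +-cancelʳ-≤ (j / T * T) _ _ (begin
        j % T + j / T * T     ≡⟨ m≡m%n+[m/n]*n j T ⟨
        j                     ≤⟨ p′ ⟩
        base (R * N) + (n ∸ r) ≤⟨ +-monoˡ-≤ (n ∸ r) (*-monoˡ-≤ T (m*o≤n⇒m≤n/o {R * N * Q} T p)) ⟩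
        j / T * T + (n ∸ r)   ≡⟨ +-comm (j / T * T) (n ∸ r) ⟩
        n ∸ r + j / T * T     ∎)

    module _ {c d : Bool} {r : ℕ} (r≤n : r ≤ n) where

      -- Blocks strictly between `L` and `R` have lower level, so their letters recur in `L`; the
      -- piece of `R` up to `rightEdge r` lies at far offsets.
      fits-L : ∀ j → base (L * N) ≤ j → j ≤ rightEdge r → Fits {c} {d} L r j
      fits-L j p p′ with j <? base (R * N)
      ... | no ¬q = inj₂ (far-right j r≤n (≮⇒≥ ¬q) p′)
      ... | yes p″ with m≤n⇒m<n∨m≡n (block-≥ L p)
      ...   | inj₂ L≡b = fits-block j (<⇒≢ L<M) (inj₁ (sym L≡b))
      ...   | inj₁ L<b = fits-block j (<⇒≢ L<M)
                           (inj₂ (subst (∣ block j - M ∣ <_) (sym ∣L-M∣) (inside L<b (block-< R p″))))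

      fits-R : ∀ j → leftEdge r ≤ j → j < base (suc R * N) → Fits {c} {d} R r j
      fits-R j p p′ with j <? base (suc L * N)
      ... | yes p″ = inj₂ (far-left j r≤n p p″)
      ... | no ¬q with m≤n⇒m<n∨m≡n (s≤s⁻¹ (block-< (suc R) p′))
      ...   | inj₂ b≡R = fits-block j (≢-sym (<⇒≢ M<R)) (inj₁ b≡R)
      ...   | inj₁ b<R = fits-block j (≢-sym (<⇒≢ M<R))
                           (inj₂ (subst (∣ block j - M ∣ <_) (sym ∣R-M∣) (inside (block-≥ (suc L) (≮⇒≥ ¬q)) b<R)))

      beyond-L : ∀ j → j ≤ lo L r → Alike c d r j j
      beyond-L j p = alike-refl j (<⇒≢ (≤-<-trans (s≤s⁻¹ (block-< (suc L) (≤-<-trans p (lo<end L r≤n)))) L<M))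

      beyond-R : ∀ j → hi R r ≤ j → Alike c d r j j
      beyond-R j p = alike-refl j (≢-sym (<⇒≢ (<-≤-trans M<R (block-≥ R (≤-trans (start≤hi R r) p)))))

      core : ∀ j → Alike c d r j j ⊎ (base (suc L * N) ≤ j × j < base (R * N))
      core j with block j ≟ M
      ... | no b≢M  = inj₁ (alike-refl j b≢M)
      ... | yes b≡M = inj₂ (≤-trans (blocks-≤ (subst (L <_) (sym b≡M) L<M)) (block-start j) ,
                           <-≤-trans (block-end j) (blocks-≤ (subst (_< R) (sym b≡M) M<R)))

    -- Unequal pebbles must leave jumps answerable both ways: `ZoneR` provides for jumps to the
    -- right, its mirror image `ZoneL` for those to the left. In both blocks, replies to the right
    -- move up with `hi` and replies to the left move down with `lo`.
    ZoneR ZoneL Zone : ℕ → ℕ → ℕ → Set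
    ZoneR r = Side _<_ _≤_ (hi R r) (lo L r) (hi L r) (leftEdge r)
    ZoneL r = Side _>_ _≥_ (lo L r) (hi R r) (lo R r) (rightEdge r)
    Zone r i i′ = i ≡ i′ ⊎ (ZoneR r i i′ × ZoneL r i i′)

    module Jumps {c d : Bool} {r : ℕ} (r<n : r < n) where

      r≤n : r ≤ n
      r≤n = <⇒≤ r<n

      leftEdge-suc : leftEdge r < leftEdge (suc r)
      leftEdge-suc = +-monoʳ-< (base (suc L * N) ∸ n) ≤-refl

      rightEdge-suc : rightEdge (suc r) < rightEdge r
      rightEdge-suc = +-monoʳ-< (base (R * N)) (≤-reflexive (sym (1+[n∸1+r]≡n∸r r<n)))

      swap : ∀ {j x y} → (∃ λ j′ → j′ < len × Alike c d r j j′ × x < j′ × j′ < y) →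
             ∃ λ j′ → j′ < len × Alike c d r j j′ × j′ < y × x < j′
      swap (j′ , p , e , a , b) = j′ , p , e , b , a

      module Right = Jump _<_ _≤_ <-trans <-≤-trans ≤-<-trans <⇒≤ (<-irrefl refl) <-≤-connex
        (hi R r) (hi R (suc r)) (leftEdge r) (leftEdge (suc r)) (lo L r) (lo L (suc r))
        (hi L r) (hi L (suc r)) (lo R r) (rightEdge r)
        (hi-suc R r<n) leftEdge-suc (lo-suc L r)
        (before<after (hiOff (suc r)) (≤-trans (n≤1+n _) (loOff<N r≤n))) (lo<hi L (suc r) r≤n)
        (before<after (hiOff r) (≤-trans (n≤1+n _) (hiOff<N r)))
        (lo<hi R (suc r) r≤n) (leftEdge≤rightEdge r≤n)
        len (Alike c d r)
        (λ j p p′ → find-hi j r<n R≤top (fits-R {c} {d} r≤n j p (<-trans p′ (hi<end R r))))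
        (λ j p p′ → find-hi j r<n L≤top
           (fits-L {c} {d} r≤n j (≤-trans (start≤lo L r) p) (<⇒≤ (<-≤-trans p′ (leftEdge≤rightEdge r≤n)))))
        (beyond-R r≤n)
        (λ j → map₂ (λ (p , p′) → ≤-trans (leftEdge≤end r≤n) p , <-≤-trans p′ (start≤hi R (suc r))) (core r≤n j))

      module Left = Jump _>_ _≥_ (flip <-trans) (flip ≤-<-trans) (flip <-≤-trans) <⇒≤ (<-irrefl refl) 
        >-≥-connex
        (lo L r) (lo L (suc r)) (rightEdge r) (rightEdge (suc r)) (hi R r) (hi R (suc r))
        (lo R r) (lo R (suc r)) (hi L r) (leftEdge r)
        (lo-suc L r) rightEdge-suc (hi-suc R r<n)
        (before<after (hiOff r) (≤-trans (n≤1+n _) (loOff<N r<n))) (lo<hi R r r<n)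
        (before<after (loOff r) (≤-trans (n≤1+n _) (loOff<N r≤n)))
        (lo<hi L r r<n) (leftEdge≤rightEdge r≤n)
        len (Alike c d r)
        (λ j p p′ → swap (find-lo j r<n L≤top (fits-L {c} {d} r≤n j (<⇒≤ (≤-<-trans (start≤lo L r) p′)) p)))
        (λ j p p′ → swap (find-lo j r<n R≤top
           (fits-R {c} {d} r≤n j (<⇒≤ (≤-<-trans (leftEdge≤rightEdge r≤n) p′)) (≤-<-trans p (hi<end R r)))))
        (beyond-L r≤n)
        (λ j → map₂ (λ (p , p′) → <⇒≤ (<-≤-trans p′ (m≤m+n _ _)) , <-≤-trans (lo<end L r<n) p) (core r≤n j))

    -- Each limit and edge gives way by at least one position per move, as much as a pebble can
    -- shift. Pebbles that stay put are included, for `sim-weaken`.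
    zone-adjacent : ∀ {r i i′ j j′} → r < n → j ≤ suc i → i ≤ suc j → j′ ≤ suc i′ → i′ ≤ suc j′ →
                    (i ≡ i′ → j ≡ j′) → Zone (suc r) i i′ → Zone r j j′
    zone-adjacent {r} {i} {i′} {j} {j′} r<n j≤ i≤ j′≤ i′≤ same = [ inj₁ ∘ same , inj₂ ∘ step ]′
      where
      open Jumps {true} {true} r<n using (leftEdge-suc; rightEdge-suc)

      up-< : ∀ {t t′} → t′ < t → i′ < t′ → j′ < t
      up-< t′<t i′<t′ = ≤-<-trans (≤-trans j′≤ i′<t′) t′<t

      up-≤ : ∀ {t t′} → t′ < t → i ≤ t′ → j ≤ t
      up-≤ t′<t i≤t′ = ≤-trans j≤ (≤-trans (s≤s i≤t′) t′<t)

      down-< : ∀ {t t′} → t < t′ → t′ < i′ → t < j′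
      down-< t<t′ t′<i′ = <-≤-trans t<t′ (s≤s⁻¹ (≤-trans t′<i′ i′≤))

      down-≤ : ∀ {t t′} → t < t′ → t′ ≤ i → t ≤ j
      down-≤ t<t′ t′≤i = s≤s⁻¹ (≤-trans (<-≤-trans t<t′ t′≤i) i≤)

      step : ZoneR (suc r) i i′ × ZoneL (suc r) i i′ → ZoneR r j j′ × ZoneL r j j′
      step ((p , s) , (p′ , s′)) =
        (up-< (hi-suc R r<n) p ,
         Sum.map (down-≤ leftEdge-suc) (Product.map (down-≤ (lo-suc L r)) (up-< (hi-suc L r<n))) s) ,
        (down-< (lo-suc L r) p′ ,
         Sum.map (up-≤ rightEdge-suc) (Product.map (up-≤ (hi-suc R r<n)) (down-< (lo-suc R r))) s′)

    zone-bounds : ∀ {r i i′} → r ≤ n → ZoneR r i i′ × ZoneL r i i′ →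
                  (lo L r ≤ i × i ≤ hi R r) × (lo L r < i′ × i′ < hi R r)
    zone-bounds {r} r≤n ((p , s) , (p′ , s′)) =
      ([ ≤-trans (<⇒≤ (<-trans (lo<hi L r r≤n) (hi<leftEdge r))) , proj₁ ]′ s ,
       [ (λ i≤ → ≤-trans i≤ (<⇒≤ (<-trans (rightEdge<lo r) (lo<hi R r r≤n)))) , proj₁ ]′ s′) ,
      p′ , p

    zone-< : ∀ {r i i′} → r ≤ n → ZoneR r i i′ × ZoneL r i i′ → suc i′ < len
    zone-< {r} r≤n z = ≤-<-trans (proj₂ (proj₂ (zone-bounds r≤n z)))
                                 (<-≤-trans (hi<end R r) (blocks-≤ (s≤s R≤top)))

  -- Both pebbles lie within the inner blocks or between them, hence past the inner ends of both
  -- outer blocks. Both sides therefore hold by their first alternative, whichever pebble is the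
  -- spoiler's.
  zone-switch : ∀ {l r i i′} (l<M : l < M) (1+l<M : suc l < M) → r ≤ n →
                Level.Zone l l<M r i i′ → Level.Zone (suc l) 1+l<M r i′ i
  zone-switch l<M 1+l<M r≤n (inj₁ i≡i′) = inj₁ (sym i≡i′)
  zone-switch {l} {r} {i} {i′} l<M 1+l<M r≤n (inj₂ z) with Inner.zone-bounds r≤n z
    where module Inner = Level l l<M
  ... | (lo≤i , i≤hi) , (lo<i′ , i′<hi) =
    inj₂ ((≤-<-trans i≤hi (<-≤-trans hi<start (start≤hi Outer.R r)) ,
           inj₁ (≤-trans (Outer.leftEdge≤end r≤n) (≤-trans end≤lo (<⇒≤ lo<i′)))) ,
          (<-≤-trans (lo<end Outer.L r≤n) (≤-trans end≤lo lo≤i) ,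
           inj₁ (≤-trans (<⇒≤ (<-trans i′<hi hi<start)) (m≤m+n _ _))))
    where
    module Inner = Level l l<M
    module Outer = Level (suc l) 1+l<M

    hi<start : hi Inner.R r < base (Outer.R * N)
    hi<start = subst (λ b → hi Inner.R r < base (b * N)) (sym (+-suc M (suc l))) (hi<end Inner.R r)

    end≤lo : base (suc Outer.L * N) ≤ lo Inner.L r
    end≤lo = subst (λ b → base (b * N) ≤ lo Inner.L r) (+-∸-assoc 1 1+l<M) (start≤lo Inner.L r)

  -- The simulation relation for the game

  record Sim (c d : Bool) (l r i i′ : ℕ) : Set where
    constructor sim
    field
      r≤n    : r ≤ n
      i<len  : i < len
      i′<len : i′ < len
      similar : Alike c d r i i′
      -- Conditional because `Level` presupposes `l < M`, which fails at the start when `M = 0`.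
      zone   : (l<M : l < M) → Level.Zone l l<M r i i′

  relativePosition : ∀ i j → i ≡ j ⊎ (suc i ≡ j ⊎ suc j ≡ i) ⊎ (suc i < j ⊎ suc j < i)
  relativePosition i j with <-cmp i j
  ... | tri≈ _ i≡j _ = inj₁ i≡j
  ... | tri< i<j _ _ = inj₂ ([ inj₂ ∘ inj₁ , inj₁ ∘ inj₁ ]′ (m≤n⇒m<n∨m≡n i<j))
  ... | tri> _ _ j<i = inj₂ ([ inj₂ ∘ inj₂ , inj₁ ∘ inj₂ ]′ (m≤n⇒m<n∨m≡n j<i))

  module _ {c d : Bool} {l r : ℕ} where

    sim-letter : ∀ {i i′} → Sim c d l r i i′ → ∀ a → letterAt (word c) i a → letterAt (word d) i′ a
    sim-letter {i} {i′} S a p = letterAt-word⁺ d i′ a (Sim.i′<len S)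
      (trans (sym (alike-symbol (Sim.similar S))) (letterAt-word⁻ c i a p))

    sim-letter⁻ : ∀ {i i′} → Sim c d l r i i′ → ∀ a → letterAt (word d) i′ a → letterAt (word c) i a
    sim-letter⁻ {i} {i′} S a p = letterAt-word⁺ c i a (Sim.i<len S)
      (trans (alike-symbol (Sim.similar S)) (letterAt-word⁻ d i′ a p))

    sim-weaken : ∀ {i i′} → Sim c d l (suc r) i i′ → Sim c d l r i i′
    sim-weaken {i} {i′} (sim r<n i< i′< e z) = sim (<⇒≤ r<n) i< i′< (alike-weaken e)
      λ l<M → Level.zone-adjacent l l<M r<n (n≤1+n i) (n≤1+n i) (n≤1+n i′) (n≤1+n i′) (λ p → p) (z l<M)

    sim-switch : ∀ {i i′} → suc l < M → Sim c d l r i i′ → Sim d c (suc l) r i′ i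
    sim-switch 1+l<M (sim r≤n i< i′< e z) =
      sim r≤n i′< i< (alike-sym e) λ 1+l<M → let l<M = <-trans (n<1+n l) 1+l<M in zone-switch l<M 1+l<M r≤n (z l<M)

    sim-forth-len : ∀ {i i′} → l < M → Sim c d l (suc r) i i′ → ∀ j → j < len →
                    ∃ λ j′ → j′ < len × Sim c d l r j j′ × SameOrder i j i′ j′
    sim-forth-len {i} {i′} l<M S@(sim r<n i< i′< e z) j j< = answer (relativePosition i j)
      where
      open Level l l<M
      module J = Jumps {c} {d} r<n

      Reply : Set
      Reply = ∃ λ j′ → j′ < len × Sim c d l r j j′ × SameOrder i j i′ j′

      up : suc i ≡ j → Reply
      up refl = suc i′ , 1+i′<len , sim J.r≤n j< 1+i′<len (alike-suc (s≤s J.r≤n) e)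
          (λ l<M → Level.zone-adjacent l l<M r<n ≤-refl (≤-trans (n≤1+n i) (n≤1+n _))
                     ≤-refl (≤-trans (n≤1+n i′) (n≤1+n _)) (cong suc) (z l<M)) ,
          next refl refl
        where
        1+i′<len : suc i′ < len
        1+i′<len = [ (λ i≡i′ → subst (λ x → suc x < len) i≡i′ j<) , zone-< r<n ]′ (z l<M)

      positive : Zone (suc r) i i′ → suc j ≡ i → ∃ λ j′ → suc j′ ≡ i′
      positive (inj₁ refl) p = j , p
      positive (inj₂ (_ , (s≤s _ , _))) _ = _ , refl

      down : suc j ≡ i → Reply
      down refl with positive (z l<M) refl
      ... | j′ , refl = j′ , j′< , sim J.r≤n j< j′< (alike-pred (s≤s J.r≤n) e)
          (λ l<M → Level.zone-adjacent l l<M r<n (≤-trans (n≤1+n j) (n≤1+n _)) ≤-refl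
                     (≤-trans (n≤1+n j′) (n≤1+n _)) ≤-refl suc-injective (z l<M)) ,
          prev refl refl
        where
        j′< : j′ < len
        j′< = <-trans (n<1+n j′) i′<

      answer : _ → Reply
      answer (inj₁ refl) = i′ , i′< , sim-weaken S , equal refl refl
      answer (inj₂ (inj₁ (inj₁ p))) = up p
      answer (inj₂ (inj₁ (inj₂ p))) = down p
      answer (inj₂ (inj₂ (inj₁ p))) with J.Right.jump (map₂ proj₁ (z l<M)) (n<1+n i) p j<
      ... | j′ , j′< , e′ , z′ , _ , i′<z , z<j′ =
        j′ , j′< , sim J.r≤n j< j′< e′ (λ _ → z′) , right p (≤-<-trans i′<z z<j′)
      answer (inj₂ (inj₂ (inj₂ p))) with J.Left.jump (map₂ proj₂ (z l<M)) p (n<1+n j) j<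
      ... | j′ , j′< , e′ , z′ , _ , z<i′ , j′<z =
        -- In the reversed order `ZoneL` comes first, hence the exchange.
        j′ , j′< , sim J.r≤n j< j′< e′ (λ _ → map₂ Product.swap z′) , left p (≤-<-trans j′<z z<i′)

    sim-forth : ∀ {i i′} → l < M → Sim c d l (suc r) i i′ → ∀ j → j < length (word c) →
                ∃ λ j′ → j′ < length (word d) × Sim c d l r j j′ × SameOrder i j i′ j′
    sim-forth l<M S j j< with sim-forth-len l<M S j (subst (j <_) (length-word c) j<)
    ... | j′ , j′< , S′ , o = j′ , subst (j′ <_) (sym (length-word d)) j′< , S′ , o

  indistinguishable : ∀ ψ → qdepth ψ ≤ n → blocks ψ ≤ M → ∀ c d → word c ⊨ ψ → word d ⊨ ψ
  indistinguishable ψ depth≤n blocks≤M c d = transfer ψ depth≤n blocks≤M start start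
    where
    open Game word M Sim sim-letter sim-letter⁻ sim-weaken sim-switch sim-forth

    origin : ∀ {c d} → Sim c d 0 n 0 0
    -- Offset 0 is far with `n` moves left. This also covers `M = 0`, where tile 0 lies in the core
    -- and the two words differ on it.
    origin = sim ≤-refl z<s z<s (alike 0 0 0 z<s refl refl (inj₂ (inj₁ ≤-refl))) (λ _ → inj₁ refl)

    start : ∀ {c d} → Config c d 0 n ⟨ 0 , 0 ⟩ ⟨ 0 , 0 ⟩
    start = config origin origin (equal refl refl)

-- The separating sentence

other : Var → Var
other vx = vy
other vy = vx

get-set : ∀ ρ v i → get (set ρ v i) v ≡ i
get-set ρ vx i = refl
get-set ρ vy i = refl

get-set-other : ∀ ρ v i → get (set ρ (other v) i) v ≡ get ρ v
get-set-other ρ vx i = refl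
get-set-other ρ vy i = refl

module Separator (M : ℕ) where

  open Letters M

  -- At positions carrying a letter of level at most M − h, mid h says that the block has level at most
  -- M − h; nmid h is the dual formula.
  mutual
    mid : ℕ → Var → Formula Q
    mid zero    v = tt
    mid (suc h) v =
      all v′ (nmid h v′ ∨ᶠ (nlab ((top ∸ h) mod Q) v′ ∨ᶠ lt v′ v)) ∧ᶠ
      all v′ (nmid h v′ ∨ᶠ (nlab (h mod Q) v′ ∨ᶠ lt v v′))
      where v′ = other v

    nmid : ℕ → Var → Formula Q
    nmid zero    v = ff
    nmid (suc h) v =
      ex v′ (mid h v′ ∧ᶠ (lab ((top ∸ h) mod Q) v′ ∧ᶠ nlt v′ v)) ∨ᶠ
      ex v′ (mid h v′ ∧ᶠ (lab (h mod Q) v′ ∧ᶠ nlt v v′))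
      where v′ = other v

  φ : Formula Q
  φ = ex vx (mid M vx ∧ᶠ lab (M mod Q) vx)

  mutual
    -- Each level adds one quantifier, universal in `mid` and existential in `nmid`, and the two
    -- formulas call each other, so each level costs one block.
    mid-blocks : ∀ h v → blocksFrom (q ∃k) (mid h v) ≤ h
    mid-blocks zero    v = z≤n
    mid-blocks (suc h) v = ⊔-lub p p
      where p = s≤s (⊔-lub (nmid-blocks h (other v)) z≤n)

    nmid-blocks : ∀ h v → blocksFrom (q ∀k) (nmid h v) ≤ h
    nmid-blocks zero    v = z≤n
    nmid-blocks (suc h) v = ⊔-lub p p
      where p = s≤s (⊔-lub (mid-blocks h (other v)) z≤n)

  mutual
    mid-closed : ∀ h v {bx by} → bound bx by v → closedIn bx by (mid h v)
    mid-closed zero    v  b = _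
    mid-closed (suc h) vx b = (nmid-closed h vy refl , refl , refl , b) , (nmid-closed h vy refl , refl , b , refl)
    mid-closed (suc h) vy b = (nmid-closed h vx refl , refl , refl , b) , (nmid-closed h vx refl , refl , b , refl)

    nmid-closed : ∀ h v {bx by} → bound bx by v → closedIn bx by (nmid h v)
    nmid-closed zero    v  b = _
    nmid-closed (suc h) vx b = (mid-closed h vy refl , refl , refl , b) , (mid-closed h vy refl , refl , b , refl)
    nmid-closed (suc h) vy b = (mid-closed h vx refl , refl , refl , b) , (mid-closed h vx refl , refl , b , refl)

  φ-blocks : blocks φ ≤ suc M
  φ-blocks = s≤s (⊔-lub (mid-blocks M vx) z≤n)

  φ-closed : Sentence φ
  φ-closed = mid-closed M vx refl , refl

  -- `nmid h` is the negation of `mid h` in negation normal form, so its witness violates the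
  -- universal statement.
  clash : ∀ w h v ρ → sat w ρ (mid h v) → ¬ sat w ρ (nmid h v)
  clash w (suc h) v ρ (p , _) (inj₁ (j , j< , p′ , l , ¬<)) with p j j<
  ... | inj₁ p″        = clash w h (other v) (set ρ (other v) j) p′ p″
  ... | inj₂ (inj₁ ¬l) = ¬l l
  ... | inj₂ (inj₂ <)  = ¬< <
  clash w (suc h) v ρ (_ , p) (inj₂ (j , j< , p′ , l , ¬<)) with p j j<
  ... | inj₁ p″        = clash w h (other v) (set ρ (other v) j) p′ p″
  ... | inj₂ (inj₁ ¬l) = ¬l l
  ... | inj₂ (inj₂ <)  = ¬< <

  -- The sentence evaluated in the words

  module _ (n : ℕ) (c : Bool) where

    open Words M n

    s≤top⇒s≢blank : ∀ {s} → s ≤ top → s ≢ blank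
    s≤top⇒s≢blank s≤top = <⇒≢ (s≤s s≤top)

    toℕ-mod : ∀ {s} → s ≤ top → toℕ (s mod Q) ≡ s
    toℕ-mod {s} s≤top = trans (toℕ-fromℕ< (m%n<n s Q)) (m<n⇒m%n≡m (s≤s (≤-trans s≤top (n≤1+n top))))

    has-label : ∀ {s} i → s ≤ top → i < len → symbol c i ≡ s → letterAt (word c) i (s mod Q)
    has-label {s} i s≤top i<len e = letterAt-word⁺ c i (s mod Q) i<len (trans e (sym (toℕ-mod s≤top)))

    label-has : ∀ {s} i → s ≤ top → letterAt (word c) i (s mod Q) → symbol c i ≡ s
    label-has {s} i s≤top p = trans (letterAt-word⁻ c i (s mod Q) p) (toℕ-mod s≤top)

    decompose : ∀ {s} i → s ≤ top → symbol c i ≡ s →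
                i ≡ P + (s + i / T / Q * Q) * T × Allowed c (block i) s
    decompose {s} i s≤top e with symbol-nonblank c i e (s≤top⇒s≢blank s≤top)
    ... | i≡ , t≡ with letter-cases c (block i) (i / T % Q)
    ...   | inj₂ (e′ , _) = ⊥-elim (s≤top⇒s≢blank s≤top (trans (sym t≡) e′))
    ...   | inj₁ (e′ , p) =
      trans i≡ (cong (λ t → P + t * T) (trans (m≡m%n+[m/n]*n (i / T) Q) (cong (_+ i / T / Q * Q) slot≡s))) ,
      subst (Allowed c (block i)) slot≡s p
      where
      slot≡s : i / T % Q ≡ s
      slot≡s = trans (sym e′) t≡

    slotAt : ℕ → ℕ → ℕ → ℕ
    slotAt s g b = P + (s + (g + b * N) * Q) * T

    P<T : P < T
    P<T = s≤s (m≤m+n P P)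

    slotAt-< : ∀ {s g b} → s ≤ top → g < N → b ≤ top → slotAt s g b < len
    slotAt-< {s} {g} {b} s≤top g<N b≤top =
      <-≤-trans (slot-< {P} {s} {g + b * N} P<T (s≤s (≤-trans s≤top (n≤1+n top))))
                (base-mono-≤ {suc g + b * N} {suc top * N} (+-mono-≤ g<N (*-monoˡ-≤ N b≤top)))

    slotAt-symbol : ∀ {s g b} → s ≤ top → g < N → Allowed c b s → symbol c (slotAt s g b) ≡ s
    slotAt-symbol {s} {g} {b} s≤top g<N p = begin
      symbol c (slotAt s g b)           ≡⟨ symbol-centre c (s + (g + b * N) * Q) ⟩
      tile c (s + (g + b * N) * Q)      ≡⟨ tile-slot c {g} {s} {b} g<N (s≤s (≤-trans s≤top (n≤1+n top))) ⟩
      letter c b s                      ≡⟨ letter-allowed p ⟩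
      s                                 ∎
      where open ≡-Reasoning

    slotAt-block : ∀ {s g b} → s ≤ top → g < N → block (slotAt s g b) ≡ b
    slotAt-block {s} {g} {b} s≤top g<N = block-slot {P} {g} {s} {b} P<T g<N (s≤s (≤-trans s≤top (n≤1+n top)))

    Inside : ℕ → ℕ → Set
    Inside h i = h ≤ block i × block i + h ≤ top

    inside? : ∀ h i → Dec (Inside h i)
    inside? h i = h ≤? block i ×-dec block i + h ≤? top

    block-<⇒< : ∀ {i j} → block i < block j → i < j
    block-<⇒< {i} {j} p with i <? j
    ... | yes i<j = i<j
    ... | no  i≮j = ⊥-elim (<⇒≱ p (block-mono (≮⇒≥ i≮j)))

    -- Apart from its boundary letter a block carries only letters below its own level, and inside
    -- `h` that level is at most the level of `s`.
    boundary-block : ∀ {s h} i → s ≤ top → h ≤ M → ∣ s - M ∣ ≡ ∣ h - M ∣ → Inside h i → symbol c i ≡ s →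
                     s + block i ≡ top
    boundary-block {s} {h} i s≤top h≤M s~h (h≤b , b+h≤top) e with decompose i s≤top e
    ... | _ , inj₁ p , _ = p
    ... | _ , inj₂ p , _ = ⊥-elim (<⇒≱ p (subst (∣ block i - M ∣ ≤_) (sym s~h) b≤h))
      where
      b≤h : ∣ block i - M ∣ ≤ ∣ h - M ∣
      b≤h = s≤s⁻¹ (∣m-n∣<o {block i} {M} {suc ∣ h - M ∣}
        (subst (block i <_) (sym (+-suc M _)) (s≤s
          (subst (block i ≤_) (trans (+-∸-assoc M h≤M) (cong (M +_) (sym (m≤n⇒∣m-n∣≡n∸m h≤M))))
                 (m+n≤o⇒m≤o∸n (block i) b+h≤top))))
        (subst (M <_) (sym (+-suc (block i) _)) (s≤s (≤-trans (m≤n+∣m-n∣ M h)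
          (+-mono-≤ h≤b (≤-reflexive (∣-∣-comm M h)))))))

    mutual
      -- A boundary letter inside `h` sits in block `h` or block `top ∸ h` by `boundary-block`, on
      -- the required side of the position; any other occurrence satisfies `nmid h` by induction.
      inside⇒mid : ∀ h → h ≤ M → ∀ v ρ → Inside h (get ρ v) → sat (word c) ρ (mid h v)
      inside⇒mid zero    _   v ρ _ = _
      inside⇒mid (suc h) h<M v ρ (h<b , b+h<top) = left-part , right-part
        where
        h≤M : h ≤ M
        h≤M = <⇒≤ h<M
        h≤top : h ≤ top
        h≤top = ≤-trans h≤M (m≤m+n M M)
        top∸h+h : top ∸ h + h ≡ top
        top∸h+h = m∸n+n≡m h≤top
        v′ = other v

        left-part : ∀ j → j < length (word c) →
          sat (word c) (set ρ v′ j) (nmid h v′ ∨ᶠ (nlab ((top ∸ h) mod Q) v′ ∨ᶠ lt v′ v))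
        left-part j j< with symbol c j ≟ top ∸ h
        ... | no ¬e = inj₂ (inj₁ λ l → ¬e (label-has j (m∸n≤m top h)
                   (subst (λ x → letterAt (word c) x ((top ∸ h) mod Q)) (get-set ρ v′ j) l)))
        ... | yes e with inside? h j
        ...   | no ¬in = inj₁ (outside⇒nmid h h≤M v′ (set ρ v′ j) (top ∸ h)
                   (subst (_< len) (sym (get-set ρ v′ j)) (subst (j <_) (length-word c) j<))
                   (subst (λ x → symbol c x ≡ top ∸ h) (sym (get-set ρ v′ j)) e)
                   (m+n≤o⇒m≤o∸n h (+-mono-≤ h≤M h≤M)) (≤-reflexive top∸h+h)
                   (subst (¬_ ∘ Inside h) (sym (get-set ρ v′ j)) ¬in))
        ...   | yes in-h = inj₂ (inj₂ (subst₂ _<_ (sym (get-set ρ v′ j)) (sym (get-set-other ρ v j))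
                   (block-<⇒< (subst (_< block (get ρ v)) (sym block≡h) h<b))))
          where
          block≡h : block j ≡ h
          block≡h = +-cancelˡ-≡ (top ∸ h) _ _ (trans
            (boundary-block j (m∸n≤m top h) h≤M (∣s-M∣≡∣b-M∣ (top ∸ h) h M top∸h+h) in-h e) (sym top∸h+h))

        right-part : ∀ j → j < length (word c) →
          sat (word c) (set ρ v′ j) (nmid h v′ ∨ᶠ (nlab (h mod Q) v′ ∨ᶠ lt v v′))
        right-part j j< with symbol c j ≟ h
        ... | no ¬e = inj₂ (inj₁ λ l → ¬e (label-has j h≤top
                   (subst (λ x → letterAt (word c) x (h mod Q)) (get-set ρ v′ j) l)))
        ... | yes e with inside? h j
        ...   | no ¬in = inj₁ (outside⇒nmid h h≤M v′ (set ρ v′ j) h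
                   (subst (_< len) (sym (get-set ρ v′ j)) (subst (j <_) (length-word c) j<))
                   (subst (λ x → symbol c x ≡ h) (sym (get-set ρ v′ j)) e)
                   ≤-refl (+-mono-≤ h≤M h≤M)
                   (subst (¬_ ∘ Inside h) (sym (get-set ρ v′ j)) ¬in))
        ...   | yes in-h = inj₂ (inj₂ (subst₂ _<_ (sym (get-set-other ρ v j)) (sym (get-set ρ v′ j))
                   (block-<⇒< (+-cancelʳ-< h _ _ (≤-trans (≤-reflexive (sym (+-suc _ h))) (≤-trans b+h<top
                     (≤-reflexive (trans (sym (boundary-block j h≤top h≤M refl in-h e)) (+-comm h _)))))))))

      -- The bounds on the symbol `s` exclude blanks: a blank after the last boundary letter of
      -- block `h` would not be separated from the middle.
      outside⇒nmid : ∀ h → h ≤ M → ∀ v ρ s → get ρ v < len → symbol c (get ρ v) ≡ s → h ≤ s → s + h ≤ top →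
                     ¬ Inside h (get ρ v) → sat (word c) ρ (nmid h v)
      outside⇒nmid zero h≤M v ρ s i< e _ _ ¬in =
        ⊥-elim (¬in (z≤n , subst (_≤ top) (sym (+-identityʳ _)) (s≤s⁻¹ (block-< (suc top) i<))))
      outside⇒nmid (suc h) h<M v ρ s i< e h<s s+h<top ¬in with block (get ρ v) ≤? h
      ... | yes b≤h = inj₁ (x , subst (x <_) (sym (length-word c)) x<len ,
              inside⇒mid h h≤M v′ (set ρ v′ x) (subst (Inside h) (sym (get-set ρ v′ x)) x-inside) ,
              subst (λ i → letterAt (word c) i ((top ∸ h) mod Q)) (sym (get-set ρ v′ x)) x-label ,
              λ x<i → <⇒≱ (subst₂ _<_ (get-set ρ v′ x) (get-set-other ρ v x) x<i) i≤x)
        where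
        v′ = other v
        x = slotAt (top ∸ h) (pred N) h
        h≤M = <⇒≤ h<M
        h≤top = ≤-trans h≤M (m≤m+n M M)
        s≤top = m+n≤o⇒m≤o s s+h<top

        x<len : x < len
        x<len = slotAt-< (m∸n≤m top h) ≤-refl h≤top

        x-inside : Inside h x
        x-inside = subst (λ b → h ≤ b × b + h ≤ top) (sym (slotAt-block (m∸n≤m top h) ≤-refl))
                         (≤-refl , +-mono-≤ h≤M h≤M)

        x-label : letterAt (word c) x ((top ∸ h) mod Q)
        x-label = has-label x (m∸n≤m top h) x<len
                    (slotAt-symbol (m∸n≤m top h) ≤-refl (inj₁ (m∸n+n≡m h≤top) , inj₂ (<⇒≢ h<M)))

        i≤x : get ρ v ≤ x
        i≤x = subst (_≤ x) (sym (proj₁ (decompose (get ρ v) s≤top e)))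
          (+-monoʳ-≤ P (*-monoˡ-≤ T (+-mono-≤
            (m+n≤o⇒m≤o∸n s (≤-trans (+-monoʳ-≤ s (n≤1+n h)) s+h<top))
            (*-monoˡ-≤ Q (subst (_≤ pred N + h * N) (sym (m≡m%n+[m/n]*n (get ρ v / T / Q) N))
              (+-mono-≤ (s≤s⁻¹ (m%n<n (get ρ v / T / Q) N)) (*-monoˡ-≤ N b≤h)))))))
      ... | no b≰h = inj₂ (y , subst (y <_) (sym (length-word c)) y<len ,
              inside⇒mid h h≤M v′ (set ρ v′ y) (subst (Inside h) (sym (get-set ρ v′ y)) y-inside) ,
              subst (λ i → letterAt (word c) i (h mod Q)) (sym (get-set ρ v′ y)) y-label ,
              λ i<y → <⇒≱ (subst₂ _<_ (get-set-other ρ v y) (get-set ρ v′ y) i<y) y≤i)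
        where
        v′ = other v
        y = slotAt h 0 (top ∸ h)
        h≤M = <⇒≤ h<M
        h≤top = ≤-trans h≤M (m≤m+n M M)
        s≤top = m+n≤o⇒m≤o s s+h<top

        y<len : y < len
        y<len = slotAt-< h≤top z<s (m∸n≤m top h)

        y-inside : Inside h y
        y-inside = subst (λ b → h ≤ b × b + h ≤ top) (sym (slotAt-block h≤top z<s))
                         (m+n≤o⇒m≤o∸n h (+-mono-≤ h≤M h≤M) , ≤-reflexive (m∸n+n≡m h≤top))

        y-label : letterAt (word c) y (h mod Q)
        y-label = has-label y h≤top y<len (slotAt-symbol h≤top z<s
          (inj₁ (m+[n∸m]≡n h≤top) ,
           inj₂ λ top∸h≡M → <⇒≢ h<M (+-cancelˡ-≡ M _ _ (trans (cong (_+ h) (sym top∸h≡M)) (m∸n+n≡m h≤top)))))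

        top∸h≤b : top ∸ h ≤ block (get ρ v)
        top∸h≤b = m≤n+o⇒m∸n≤o top h (subst (top ≤_) (+-comm _ h) (s≤s⁻¹
          (subst (top <_) (+-suc _ h) (≰⇒> λ b+h<top → ¬in (≰⇒> b≰h , b+h<top)))))

        y≤i : y ≤ get ρ v
        y≤i = subst (y ≤_) (sym (proj₁ (decompose (get ρ v) s≤top e)))
          (+-monoʳ-≤ P (*-monoˡ-≤ T (+-mono-≤ (<⇒≤ h<s)
            (*-monoˡ-≤ Q (≤-trans (*-monoˡ-≤ N top∸h≤b) (m/n*n≤m (get ρ v / T / Q) N))))))

  φ-true : ∀ n → Words.word M n true ⊨ φ
  φ-true n = x , subst (x <_) (sym (length-word true)) x<len ,
    inside⇒mid n true M ≤-refl vx ⟨ x , 0 ⟩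
      (subst (λ b → M ≤ b × b + M ≤ top) (sym (slotAt-block n true M≤top z<s)) (≤-refl , ≤-refl)) ,
    has-label n true x M≤top x<len (slotAt-symbol n true M≤top z<s (inj₁ refl , inj₁ refl))
    where
    open Words M n
    x = slotAt n true M 0 M
    M≤top = m≤m+n M M
    x<len : x < len
    x<len = slotAt-< n true M≤top z<s M≤top

  φ-false : ∀ n → ¬ (Words.word M n false ⊨ φ)
  φ-false n (i , i< , p , l) = clash (word false) M vx ⟨ i , 0 ⟩ p
    (outside⇒nmid n false M ≤-refl vx ⟨ i , 0 ⟩ M (subst (i <_) (length-word false) i<) e ≤-refl ≤-refl ¬inside)
    where
    open Words M n
    M≤top = m≤m+n M M

    e : symbol false i ≡ M
    e = label-has n false i M≤top l

    -- For `h = M` the inside is the core alone, which is blank in this word.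
    ¬inside : ¬ Inside n false M i
    ¬inside (M≤b , b+M≤top) with proj₂ (proj₂ (decompose n false i M≤top e))
    ... | inj₂ b≢M = b≢M (≤-antisym (+-cancelʳ-≤ M _ _ b+M≤top) M≤b)

theorem5p6 : (m : ℕ) → 1 ≤ m →
    Σ ℕ λ k → Σ (Language k) λ K → Σ (Language k) λ L →
    (Σ (Formula k) λ φ → Sentence φ × InFO2 m φ × Separates φ K L)
    × ((ψ : Formula k) → Sentence ψ → InFO2 (m ∸ 1) ψ → ¬ Separates ψ K L)
theorem5p6 (suc M) _ =
  Q , language true , language false ,
  (φ , φ-closed , φ-blocks , inj₁ ((λ { _ (n , refl) → φ-true n }) , (λ { _ (n , refl) → φ-false n }))) ,
  λ { ψ _ blocks≤M (inj₁ (K⊨ , L⊭)) → L⊭ _ (_ , refl) (same ψ blocks≤M true false (K⊨ _ (_ , refl)))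
    ; ψ _ blocks≤M (inj₂ (L⊨ , K⊭)) → K⊭ _ (_ , refl) (same ψ blocks≤M false true (L⊨ _ (_ , refl))) }
  where
  open Letters M using (Q)
  open Separator M

  -- The words for all `n` are collected over one alphabet, which depends only on `M`; a given `ψ`
  -- then fails on the pair with `n = qdepth ψ`.
  language : Bool → Language Q
  language c w = ∃ λ n → w ≡ Words.word M n c

  same : ∀ ψ → blocks ψ ≤ M → ∀ c d → Words.word M (qdepth ψ) c ⊨ ψ → Words.word M (qdepth ψ) d ⊨ ψ
  same ψ blocks≤M = Strategy.indistinguishable M (qdepth ψ) ψ ≤-refl blocks≤M
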